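{- For every special $\Pi^0_1$ sets $P,Q\subseteq2^{\mathbb N}$, and for any $R\subseteq\mathbb N^{\mathbb N}$, if $P\le^1_\omega(Q\blacktriangledown P)\otimes R$ then $P\le^1_\omega R$.
   Context: A set is special if it is nonempty and contains no computable element. For $f,g\in\mathbb N^{\mathbb N}$, $(f\oplus g)(2n)=f(n)$ and $(f\oplus g)(2n+1)=g(n)$; $A\otimes B=\{f\oplus g:f\in A,\ g\in B\}$. With each $\Pi^0_1$ set $P\subseteq2^{\mathbb N}$ (given by an index) a corresponding computable tree $T_P\subseteq2^{<\mathbb N}$ whose set of infinite paths is $P$ is fixed; $L_P$ is the set of leaves (dead ends) of $T_P$. The hyperconcatenation $Q\blacktriangledown P$ is the iterated concatenation of copies of $P$ along the tree $T_Q$: it is the set of infinite paths of the tree of all initial segments of strings of the form $$\rho_0{}^\frown\langle\tau(0)\rangle^\frown\rho_1{}^\frown\langle\tau(1)\rangle^\frown\cdots{}^\frown\rho_{n-1}{}^\frown\langle\tau(n-1)\rangle^\frown\sigma,$$ where $\tau\in T_Q$, $n=|\tau|$, $\rho_0,\dots,\rho_{n-1}\in L_P$ and $\sigma\in T_P$. Let $\{\Phi_e\}_{e\in\mathbb N}$ be an effective enumeration of all partial computable functions $\Phi_e:\subseteq\mathbb N^{\mathbb N}\to\mathbb N^{\mathbb N}$. A learner is a total computable function $\Psi:\mathbb N^{<\mathbb N}\to\mathbb N$. For $A,B\subseteq\mathbb N^{\mathbb N}$, $A\le^1_\omega B$ means there are a partial function $\Gamma:\subseteq\mathbb N^{\mathbb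 N}\to\mathbb N^{\mathbb N}$ with $B\subseteq\mathrm{dom}(\Gamma)$ and $\Gamma(g)\in A$ for all $g\in B$, and a learner $\Psi$ such that for every $g\in\mathrm{dom}(\Gamma)$ the limit $\lim_n\Psi(g\upharpoonright n)$ exists and $\Phi_{\lim_n\Psi(g\upharpoonright n)}(g)=\Gamma(g)$. -}

module Defs where

open import Level using (0ℓ; _⊔_) renaming (suc to lsuc)
open import Data.Nat using (ℕ; zero; suc; _+_; _*_; _<_; _≤_)
open import Data.Nat.Properties using (+-suc)
open import Data.List using (List; []; _∷_; _++_; _∷ʳ_; applyUpTo)
open import Data.List.Relation.Unary.All using (All)
open import Data.List.Relation.Binary.Prefix.Heterogeneous using (Prefix)
open import Data.Product using (∃-syntax; _×_)
open import Function using (_∘_)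
open import Function.Bundles using (_⇔_)
open import Relation.Nullary using (¬_)
open import Relation.Unary using (Pred; _∈_; _∉_; _⊆_; _≐_; Satisfiable)
open import Relation.Binary.PropositionalEquality
  using (_≡_; _≗_; refl)

-- Cantor space 2^ℕ is the subspace of sequences with values in {0,1}.
-- Since function extensionality is not assumed, sequences are compared
-- with _≗_.
Baire : Set
Baire = ℕ → ℕ

Str : Set
Str = List ℕ

infix 7 _↾_

_↾_ : Baire → ℕ → Str
f ↾ n = applyUpTo f n

infix 4 _⊑_

_⊑_ : Str → Str → Set
_⊑_ = Prefix _≡_

infixr 6 _⊕_ _⊗_

_⊕_ : Baire → Baire → Baire
(f ⊕ g) zero    = f 0
(f ⊕ g) (suc n) = (g ⊕ (f ∘ suc)) n

⊕-even : ∀ f g n → (f ⊕ g) (2 * n) ≡ f n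
⊕-even f g zero = refl
⊕-even f g (suc n) rewrite +-suc n (n + 0) = ⊕-even (f ∘ suc) (g ∘ suc) n

⊕-odd : ∀ f g n → (f ⊕ g) (suc (2 * n)) ≡ g n
⊕-odd f g n = ⊕-even g (f ∘ suc) n

_⊗_ : ∀ {a b} → Pred Baire a → Pred Baire b → Pred Baire (a ⊔ b)
(A ⊗ B) h = ∃[ f ] ∃[ g ] (f ∈ A × g ∈ B × h ≗ f ⊕ g)

triangle : ℕ → ℕ
triangle zero    = 0
triangle (suc n) = suc n + triangle n

-- Cantor's bijection ℕ × ℕ → ℕ.
⟨_,_⟩ : ℕ → ℕ → ℕ
⟨ a , b ⟩ = triangle (a + b) + b

⌜_⌝ : Str → ℕ
⌜ [] ⌝    = 0
⌜ x ∷ σ ⌝ = suc ⟨ x , ⌜ σ ⌝ ⟩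

-- Oracle μ-recursive functions, with all arguments packed into a single
-- number by ⟨_,_⟩.
data Code : Set where
  zero succ left right oracle : Code
  pair comp prec              : Code → Code → Code
  mu                          : Code → Code

infix 4 _⊢_·_⇓_

-- g ⊢ c · x ⇓ y : program c with oracle g halts on input x with output y.
data _⊢_·_⇓_ (g : Baire) : Code → ℕ → ℕ → Set where
  zero   : ∀ {x} → g ⊢ zero · x ⇓ 0
  succ   : ∀ {x} → g ⊢ succ · x ⇓ suc x
  left   : ∀ {a b} → g ⊢ left · ⟨ a , b ⟩ ⇓ a
  right  : ∀ {a b} → g ⊢ right · ⟨ a , b ⟩ ⇓ b
  oracle : ∀ {x} → g ⊢ oracle · x ⇓ g x
  pair   : ∀ {c d x y z} →
           g ⊢ c · x ⇓ y → g ⊢ d · x ⇓ z → g ⊢ pair c d · x ⇓ ⟨ y , z ⟩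
  comp   : ∀ {c d x y z} →
           g ⊢ d · x ⇓ y → g ⊢ c · y ⇓ z → g ⊢ comp c d · x ⇓ z
  prec-zero : ∀ {c d a y} →
              g ⊢ c · a ⇓ y → g ⊢ prec c d · ⟨ a , 0 ⟩ ⇓ y
  prec-suc  : ∀ {c d a n y z} →
              g ⊢ prec c d · ⟨ a , n ⟩ ⇓ y →
              g ⊢ d · ⟨ a , ⟨ n , y ⟩ ⟩ ⇓ z →
              g ⊢ prec c d · ⟨ a , suc n ⟩ ⇓ z
  mu     : ∀ {c a n} →
           g ⊢ c · ⟨ a , n ⟩ ⇓ 0 →
           (∀ m → m < n → ∃[ k ] g ⊢ c · ⟨ a , m ⟩ ⇓ suc k) →
           g ⊢ mu c · a ⇓ n

-- Computability without an oracle is computability with a zero oracle.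
Computable : Pred Baire 0ℓ
Computable f = ∃[ c ] ∀ x → (λ _ → 0) ⊢ c · x ⇓ f x

ComputableOnStr : Pred (Str → ℕ) 0ℓ
ComputableOnStr ψ = ∃[ c ] ∀ σ → (λ _ → 0) ⊢ c · ⌜ σ ⌝ ⇓ ψ σ

ComputableSet : Pred (Pred Str 0ℓ) 0ℓ
ComputableSet S = ∃[ χ ] (ComputableOnStr χ × (∀ σ → σ ∈ S ⇔ χ σ ≡ 1))

# : Code → ℕ
# zero       = ⟨ 0 , 0 ⟩
# succ       = ⟨ 0 , 1 ⟩
# left       = ⟨ 0 , 2 ⟩
# right      = ⟨ 0 , 3 ⟩
# oracle     = ⟨ 0 , 4 ⟩
# (pair c d) = ⟨ 1 , ⟨ # c , # d ⟩ ⟩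
# (comp c d) = ⟨ 2 , ⟨ # c , # d ⟩ ⟩
# (prec c d) = ⟨ 3 , ⟨ # c , # d ⟩ ⟩
# (mu c)     = ⟨ 4 , # c ⟩

-- Φ e g ≃ h : the e-th partial computable function is defined at g and
-- its value there is h.  Numbers e that are not of the form # c index the
-- nowhere defined function.
Φ_·_≃_ : ℕ → Baire → Baire → Set
Φ e · g ≃ h = ∃[ c ] (# c ≡ e × (∀ n → g ⊢ c · n ⇓ h n))

record PartialFunction : Set₁ where
  field
    dom      : Pred Baire 0ℓ
    apply    : ∀ g → g ∈ dom → Baire
    respects : ∀ {g h} (p : g ∈ dom) (q : h ∈ dom) → g ≗ h → apply g p ≗ apply h q

record Learner : Set where
  field
    guess      : Str → ℕ
    computable : ComputableOnStr guess

_⟶_ : (ℕ → ℕ) → ℕ → Set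
s ⟶ e = ∃[ N ] (∀ n → N ≤ n → s n ≡ e)

infix 4 _≤¹ω_

record _≤¹ω_ {a b} (A : Pred Baire a) (B : Pred Baire b) : Set (lsuc 0ℓ ⊔ a ⊔ b) where
  field
    Γ : PartialFunction
    Ψ : Learner

  open PartialFunction Γ
  open Learner Ψ

  field
    defined : B ⊆ dom
    correct : ∀ g (p : g ∈ B) → apply g (defined p) ∈ A
    learns  : ∀ g (p : g ∈ dom) →
              ∃[ e ] ((λ n → guess (g ↾ n)) ⟶ e × Φ e · g ≃ apply g p)

Special : ∀ {a} → Pred Baire a → Set a
Special A = Satisfiable A × (∀ f → f ∈ A → ¬ Computable f)

record IsBinaryTree (T : Pred Str 0ℓ) : Set where
  field
    binary : ∀ σ → σ ∈ T → All (_< 2) σ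
    closed : ∀ σ τ → σ ⊑ τ → τ ∈ T → σ ∈ T

Paths : Pred Str 0ℓ → Pred Baire 0ℓ
Paths T f = ∀ n → f ↾ n ∈ T

Leaf : Pred Str 0ℓ → Pred Str 0ℓ
Leaf T σ = σ ∈ T × (∀ x → (σ ∷ʳ x) ∉ T)

-- A Π⁰₁ subset of Cantor space together with the tree attached to it.
record Π⁰₁ (P : Pred Baire 0ℓ) : Set₁ where
  field
    tree       : Pred Str 0ℓ
    isTree     : IsBinaryTree tree
    computable : ComputableSet tree
    paths      : P ≐ Paths tree

-- Blocks L τ w : w = ρ₀ ⌢ ⟨τ(0)⟩ ⌢ ⋯ ⌢ ρₙ₋₁ ⌢ ⟨τ(n-1)⟩ with n = |τ| and
-- all ρᵢ ∈ L.
data Blocks (L : Pred Str 0ℓ) : Str → Str → Set where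
  []    : Blocks L [] []
  block : ∀ {ρ x τ w} → ρ ∈ L → Blocks L τ w → Blocks L (x ∷ τ) (ρ ++ x ∷ w)

hyperTree : Pred Str 0ℓ → Pred Str 0ℓ → Pred Str 0ℓ
hyperTree TQ TP s =
  ∃[ τ ] ∃[ w ] ∃[ σ ] (τ ∈ TQ × Blocks (Leaf TP) τ w × σ ∈ TP × s ⊑ w ++ σ)

infixr 6 _▼_

-- The operation depends on the trees attached to the two sets.
_▼_ : ∀ {Q P} → Π⁰₁ Q → Π⁰₁ P → Pred Baire 0ℓ
𝐐 ▼ 𝐏 = Paths (hyperTree (Π⁰₁.tree 𝐐) (Π⁰₁.tree 𝐏))

{-# OPTIONS --safe #-}
module Submission where

open import Defs
open import Level using (Level; 0ℓ)
open import Data.Nat using (ℕ; zero; suc; pred; _+_; _∸_; _<_; _≤_; z≤n; s≤s; _⊔_)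
open import Data.Nat.Properties
open import Data.Bool using (Bool; true; false; if_then_else_; _∧_; not)
open import Data.Maybe using (Maybe; just; nothing; maybe; fromMaybe)
open import Data.Maybe.Properties using (just-injective)
open import Data.List using (List; []; _∷_; _++_; _∷ʳ_; length; foldl; applyUpTo; _ʳ++_; reverse)
open import Data.List.Properties using (++-assoc; ++-identityʳ; length-++; length-applyUpTo; ʳ++-defn; reverse-involutive; applyUpTo-∷ʳ; foldl-∷ʳ)
open import Data.Product using (Σ; ∃; ∃-syntax; _×_; _,_; proj₁; proj₂; uncurry)
open import Data.Sum using (_⊎_; inj₁; inj₂)
open import Data.List.Relation.Unary.All using (All; []; _∷_)
open import Data.List.Relation.Unary.All.Properties using (++⁻ʳ)
open import Data.List.Relation.Binary.Prefix.Heterogeneous using ([]; _∷_)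
open import Function.Bundles using (Equivalence)
open import Axiom.ExcludedMiddle using (ExcludedMiddle)
open import Function using (_∘_; id)
open import Relation.Unary using (Pred; _∈_; _∉_)
open import Relation.Nullary.Decidable using (decidable-stable)
open import Relation.Nullary using (¬_; yes; no; contradiction)
open import Relation.Binary.PropositionalEquality

-- Fix g ∈ R.  Suppose that, after every string w of blocks along a fixed
-- τ ∈ Q, the given learner still changed its mind on some w ⌢ σ or
-- w ⌢ ρ ⌢ ⟨x⟩ ⌢ σ, where σ ∈ T_P, ρ is a leaf and x is the next value of τ.
-- Since every string of T_P extends to a leaf (P has no computable
-- element), such changes can be strung together to an element of Q ▼ P on
-- which the learner does not converge.  Hence some pair (w , x) is locked,
-- i.e. no change occurs.  As this can be refuted from finitely much of g, a
-- new learner finds a locked pair in the limit.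
--
-- For a locked pair, with final guess c, both f ↦ Φ_c(w f ⊕ g) and, for
-- every leaf ρ, Θ_ρ : f ↦ Φ_c(w ρ x f ⊕ g) map P into P.  The first map is
-- approximated by what Φ_c computes from w ρ x for leaves ρ that agree with
-- f for long.  So one can search for leaves ρ₀, ρ₁, … such that
-- Θ_ρ₀(Θ_ρ₁(⋯ Θ_ρₖ(σ))) is already defined at k for the empty string σ.
-- These values form, for every k, an initial segment of an element of P,
-- and hence an element of P that is computable from g.

-- Extendibility to a path of P is undecidable, since otherwise the leftmost path would be
-- computable. A lock is therefore tested on all σ in T_P, even on those with no path above them; a
-- change on such a σ is still met by an element of Q ▼ P, because a leaf above σ closes the block.
-- A leaf ρ has two roles. Up to its end it can pass for an element f₀ of P, which makes Φ_c output
-- as much of Φ_c(w f₀ ⊕ g) as desired. Once it is chosen, the letter x opens a new copy of P, so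
-- that Θ_ρ maps P into P however ρ was found. No element of P computable from g is available to
-- start from. Hence the innermost argument is the empty string, an initial segment of every f ∈ P:
-- a value obtained from it is common to all Θ_ρ₀(⋯ Θ_ρₖ(f)), and it survives when f is replaced by
-- the image under a further map. Excluded middle enters only the verification; the learner and the
-- extracting program are explicit.

-- Pairing

-- Cantor's order runs along an antidiagonal and then to the start of the next one, so the pairing
-- is inverted by iterating a successor.
next : ℕ × ℕ → ℕ × ℕ
next (zero  , b) = suc b , 0
next (suc a , b) = a , suc b

unpair : ℕ → ℕ × ℕ
unpair zero    = 0 , 0
unpair (suc n) = next (unpair n)

⟨⟩-suc : ∀ a b → ⟨ a , suc b ⟩ ≡ suc ⟨ suc a , b ⟩
⟨⟩-suc a b = trans (cong (λ k → triangle k + suc b) (+-suc a b)) (+-suc _ b)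

⟨⟩-wrap : ∀ b → ⟨ suc b , 0 ⟩ ≡ suc ⟨ 0 , b ⟩
⟨⟩-wrap b rewrite +-identityʳ b | +-identityʳ (b + triangle b) = cong suc (+-comm b (triangle b))

⟨⟩-next : ∀ p → uncurry ⟨_,_⟩ (next p) ≡ suc (uncurry ⟨_,_⟩ p)
⟨⟩-next (zero  , b) = ⟨⟩-wrap b
⟨⟩-next (suc a , b) = ⟨⟩-suc a b

⟨⟩-unpair : ∀ n → uncurry ⟨_,_⟩ (unpair n) ≡ n
⟨⟩-unpair zero    = refl
⟨⟩-unpair (suc n) = trans (⟨⟩-next (unpair n)) (cong suc (⟨⟩-unpair n))

unpair-unique : ∀ n a b → ⟨ a , b ⟩ ≡ n → unpair n ≡ (a , b)
unpair-unique zero    zero    zero    eq = refl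
unpair-unique zero    (suc a) zero    ()
unpair-unique zero    a       (suc b) eq with () ← trans (sym (⟨⟩-suc a b)) eq
unpair-unique (suc n) zero    zero    ()
unpair-unique (suc n) (suc a) zero    eq
  rewrite unpair-unique n 0 a (suc-injective (trans (sym (⟨⟩-wrap a)) eq)) = refl
unpair-unique (suc n) a       (suc b) eq
  rewrite unpair-unique n (suc a) b (suc-injective (trans (sym (⟨⟩-suc a b)) eq)) = refl

unpair-⟨⟩ : ∀ a b → unpair ⟨ a , b ⟩ ≡ (a , b)
unpair-⟨⟩ a b = unpair-unique _ a b refl

⟨⟩-injective : ∀ {a b c d} → ⟨ a , b ⟩ ≡ ⟨ c , d ⟩ → (a , b) ≡ (c , d)
⟨⟩-injective {a} {b} {c} {d} eq =
  trans (sym (unpair-⟨⟩ a b)) (trans (cong unpair eq) (unpair-⟨⟩ c d))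

n≤⟨m,n⟩ : ∀ m n → n ≤ ⟨ m , n ⟩
n≤⟨m,n⟩ m n = m≤n+m n (triangle (m + n))

-- Computable functions between encoded types

-- Most functions that must be computable are written with these eliminators instead of pattern
-- matching, so that their programs are assembled in the same shape.
natrec : {X : Set} → X → (ℕ → X → X) → ℕ → X
natrec z s zero    = z
natrec z s (suc n) = s n (natrec z s n)

caseℕ : {X : Set} → ℕ → X → (ℕ → X) → X
caseℕ zero    z s = z
caseℕ (suc n) z s = s n

branch : {X : Set} → ℕ → X → X → X
branch zero    x y = x
branch (suc _) x y = y

caseList : {X Y : Set} → List X → Y → (X → List X → Y) → Y
caseList []       y f = y
caseList (x ∷ xs) y f = f x xs

infixr 7 _⊠_

data Ty : Set where
  nat bool code : Ty
  _⊠_           : Ty → Ty → Ty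
  list may      : Ty → Ty

⟦_⟧ : Ty → Set
⟦ nat ⟧    = ℕ
⟦ bool ⟧   = Bool
⟦ code ⟧   = Code
⟦ A ⊠ B ⟧  = ⟦ A ⟧ × ⟦ B ⟧
⟦ list A ⟧ = List ⟦ A ⟧
⟦ may A ⟧  = Maybe ⟦ A ⟧

encList : {X : Set} → (X → ℕ) → List X → ℕ
encList e []       = 0
encList e (x ∷ xs) = suc ⟨ e x , encList e xs ⟩

enc : ∀ A → ⟦ A ⟧ → ℕ
enc nat      n        = n
enc bool     false    = 0
enc bool     true     = 1
enc code     c        = # c
enc (A ⊠ B)  (a , b)  = ⟨ enc A a , enc B b ⟩
enc (list A) l        = encList (enc A) l
enc (may A)  nothing  = 0
enc (may A)  (just a) = suc (enc A a)

⌜⌝≡enc : ∀ σ → ⌜ σ ⌝ ≡ enc (list nat) σ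
⌜⌝≡enc []      = refl
⌜⌝≡enc (x ∷ σ) = cong (λ k → suc ⟨ x , k ⟩) (⌜⌝≡enc σ)

length≤encList : ∀ {X : Set} (e : X → ℕ) l → length l ≤ encList e l
length≤encList e []      = z≤n
length≤encList e (x ∷ l) = s≤s (≤-trans (length≤encList e l) (n≤⟨m,n⟩ (e x) _))

-- Computability relative to an oracle, uniformly: one program serves all oracles `g`.
record Comp (A B : Ty) (f : Baire → ⟦ A ⟧ → ⟦ B ⟧) : Set where
  constructor _by_
  field
    prog    : Code
    correct : ∀ g a → g ⊢ prog · enc A a ⇓ enc B (f g a)

open Comp

infix 3 _by_

variable
  A B C D X : Ty

extᶜ : ∀ {f f′} → Comp A B f → (∀ g a → f g a ≡ f′ g a) → Comp A B f′
extᶜ {A} {B} (c by p) eq = c by λ g a → subst (λ b → g ⊢ c · enc A a ⇓ enc B b) (eq g a) (p g a)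

-- A program sees encodings only, so a computation on bare numbers counts as one on the data that
-- they encode.
castᶜ : ∀ {f f′} → Comp A B f → (h : ⟦ C ⟧ → ⟦ A ⟧) → (∀ c → enc A (h c) ≡ enc C c) →
        (∀ g c → enc B (f g (h c)) ≡ enc D (f′ g c)) → Comp C D f′
castᶜ (c by p) h eq eq′ = c by λ g a →
  subst₂ (g ⊢ c ·_⇓_) (eq a) (eq′ g a) (p g (h a))

-- Splitting and pairing again is the identity because every number is a pair.
I : Code
I = pair left right

I-correct : ∀ {g} n → g ⊢ I · n ⇓ n
I-correct {g} n = subst (λ k → g ⊢ I · k ⇓ k) (⟨⟩-unpair n)
  (pair (left {a = proj₁ (unpair n)} {proj₂ (unpair n)}) (right {a = proj₁ (unpair n)}))

K : ℕ → Code
K zero    = zero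
K (suc n) = comp succ (K n)

K-correct : ∀ {g x} n → g ⊢ K n · x ⇓ n
K-correct zero    = zero
K-correct (suc n) = comp (K-correct n) succ

abstract
  relabel : ∀ {f} → (∀ g a → enc A a ≡ enc B (f g a)) → Comp A B f
  relabel {A} {B} eq = I by λ g a → subst (λ b → g ⊢ I · enc A a ⇓ b) (eq g a) (I-correct _)

  constᶜ : (b : ⟦ B ⟧) → Comp A B (λ _ _ → b)
  constᶜ {B} b = K (enc B b) by λ g a → K-correct _

  oracleᶜ : Comp nat nat (λ g x → g x)
  oracleᶜ = oracle by λ g a → oracle

  fst : Comp (A ⊠ B) A (λ _ → proj₁)
  fst {A} {B} = left by λ g a → left {a = enc A (proj₁ a)} {enc B (proj₂ a)}

  snd : Comp (A ⊠ B) B (λ _ → proj₂)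
  snd {A} {B} = right by λ g a → right {a = enc A (proj₁ a)} {enc B (proj₂ a)}

  _,ᶜ_ : ∀ {f h} → Comp A B f → Comp A C h → Comp A (B ⊠ C) (λ g a → f g a , h g a)
  (c by p) ,ᶜ (d by q) = pair c d by λ g a → pair (p g a) (q g a)

  app : ∀ {f h} → Comp B C f → Comp A B h → Comp A C (λ g a → f g (h g a))
  app (c by p) (d by q) = comp c d by λ g a → comp (q g a) (p g _)

infixr 4 _,ᶜ_

idᶜ : Comp A A (λ _ a → a)
idᶜ = relabel λ _ _ → refl

wk : ∀ {f} → Comp A B f → Comp (A ⊠ X) B (λ g p → f g (proj₁ p))
wk c = app c fst

abstract
  sucᶜ : ∀ {f} → Comp A nat f → Comp A nat (λ g a → suc (f g a))
  sucᶜ (c by p) = comp succ c by λ g a → comp (p g a) succ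

  natrecᶜ : ∀ {n z s} → Comp A nat n → Comp A B z → Comp (A ⊠ nat ⊠ B) B s →
            Comp A B (λ g a → natrec (z g a) (λ k b → s g (a , k , b)) (n g a))
  natrecᶜ {A} {B} {n} {z} {s} (cn by pn) (cz by pz) (cs by ps) =
    comp (prec cz cs) (pair I cn) by λ g a →
      comp (pair (I-correct (enc A a)) (pn g a)) (go g a (n g a))
    where
    go : ∀ g a k → g ⊢ prec cz cs · ⟨ enc A a , k ⟩ ⇓
           enc B (natrec (z g a) (λ k b → s g (a , k , b)) k)
    go g a zero    = prec-zero {a = enc A a} (pz g a)
    go g a (suc k) = prec-suc {a = enc A a} (go g a k) (ps g (a , k , _))

caseᶜ : ∀ {n z s} → Comp A nat n → Comp A B z → Comp (A ⊠ nat) B s →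
        Comp A B (λ g a → caseℕ (n g a) (z g a) (λ k → s g (a , k)))
caseᶜ {n = n} cn cz cs = extᶜ (natrecᶜ cn cz (app cs (fst ,ᶜ app fst snd)))
  λ g a → lem (n g a)
  where
  lem : ∀ {X : Set} {z : X} {s : ℕ → X} n → natrec z (λ k _ → s k) n ≡ caseℕ n z s
  lem zero    = refl
  lem (suc n) = refl

branchᶜ : ∀ {n f h} → Comp A nat n → Comp A B f → Comp A B h →
          Comp A B (λ g a → branch (n g a) (f g a) (h g a))
branchᶜ {n = n} cn cf ch = extᶜ (caseᶜ cn cf (wk ch)) λ g a → lem (n g a)
  where
  lem : ∀ {X : Set} {x y : X} n → caseℕ n x (λ _ → y) ≡ branch n x y
  lem zero    = refl
  lem (suc n) = refl

ifᶜ : ∀ {b f h} → Comp A bool b → Comp A B f → Comp A B h →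
      Comp A B (λ g a → if b g a then f g a else h g a)
ifᶜ {b = b} cb cf ch =
  extᶜ (branchᶜ (app (relabel {bool} {nat} λ _ _ → refl) cb) ch cf) λ g a → lem (b g a)
  where
  lem : ∀ {X : Set} {x y : X} b → branch (enc bool b) y x ≡ (if b then x else y)
  lem false = refl
  lem true  = refl

signᶜ : ∀ {f} → Comp A nat f → Comp A nat (λ g a → branch (f g a) 0 1)
signᶜ cf = branchᶜ cf (constᶜ 0) (constᶜ 1)

predᶜ : ∀ {f} → Comp A nat f → Comp A nat (λ g a → pred (f g a))
predᶜ {f = f} cf = extᶜ (caseᶜ cf (constᶜ 0) snd) λ g a → lem (f g a)
  where
  lem : ∀ n → caseℕ n 0 id ≡ pred n
  lem zero    = refl
  lem (suc n) = refl

-- prec evaluates its step at all smaller arguments, which need not encode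
-- anything when the scrutinee is not a number; hence the recursion
-- argument is the sign of the scrutinee, which itself is passed along.
whenSuc : Code → Code → Code → Code
whenSuc n z s =
  comp (prec (comp z left)
             (comp s (pair (comp left left) (comp (prog (predᶜ idᶜ)) (comp right left)))))
       (pair (pair I n) (comp (prog (signᶜ idᶜ)) n))

module _ {g : Baire} {n z s : Code} {a y : ℕ} (z⇓ : g ⊢ z · a ⇓ y) where

  whenSuc-zero : g ⊢ n · a ⇓ 0 → g ⊢ whenSuc n z s · a ⇓ y
  whenSuc-zero n⇓ =
    comp (pair (pair (I-correct a) n⇓) (comp n⇓ (correct (signᶜ idᶜ) g 0)))
         (prec-zero {a = ⟨ a , 0 ⟩} (comp (left {a = a} {0}) z⇓))

  whenSuc-suc : ∀ {m y′} → g ⊢ n · a ⇓ suc m → g ⊢ s · ⟨ a , m ⟩ ⇓ y′ →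
                g ⊢ whenSuc n z s · a ⇓ y′
  whenSuc-suc {m} n⇓ s⇓ =
    comp (pair (pair (I-correct a) n⇓) (comp n⇓ (correct (signᶜ idᶜ) g (suc m))))
         (prec-suc {a = a′} (prec-zero {a = a′} (comp (left {a = a} {suc m}) z⇓))
           (comp (pair (comp (left {a = a′} {r}) (left {a = a} {suc m}))
                       (comp (comp (left {a = a′} {r}) (right {a = a} {suc m}))
                             (correct (predᶜ idᶜ) g (suc m))))
                 s⇓))
    where
    a′ r : ℕ
    a′ = ⟨ a , suc m ⟩
    r  = ⟨ 0 , y ⟩

abstract
  caseListᶜ : ∀ {l z s} → Comp A (list X) l → Comp A B z → Comp (A ⊠ X ⊠ list X) B s →
    Comp A B (λ g a → caseList (l g a) (z g a) (λ x xs → s g (a , x , xs)))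
  caseListᶜ {A} {X} {B} {l} {z} {s} (cl by pl) (cz by pz) (cs by ps) =
    whenSuc cl cz cs by λ g a → go g a (l g a) (pl g a)
    where
    go : ∀ g a l → g ⊢ cl · enc A a ⇓ encList (enc X) l → g ⊢ whenSuc cl cz cs · enc A a ⇓
           enc B (caseList l (z g a) (λ x xs → s g (a , x , xs)))
    go g a []       l⇓ = whenSuc-zero (pz g a) l⇓
    go g a (x ∷ xs) l⇓ = whenSuc-suc (pz g a) l⇓ (ps g (a , x , xs))

  maybeᶜ : ∀ {m z s} → Comp (A ⊠ X) B s → Comp A B z → Comp A (may X) m →
    Comp A B (λ g a → maybe (λ x → s g (a , x)) (z g a) (m g a))
  maybeᶜ {A} {X} {B} {m} {z} {s} (cs by ps) (cz by pz) (cm by pm) =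
    whenSuc cm cz cs by λ g a → go g a (m g a) (pm g a)
    where
    go : ∀ g a m → g ⊢ cm · enc A a ⇓ enc (may X) m → g ⊢ whenSuc cm cz cs · enc A a ⇓
           enc B (maybe (λ x → s g (a , x)) (z g a) m)
    go g a nothing  m⇓ = whenSuc-zero (pz g a) m⇓
    go g a (just x) m⇓ = whenSuc-suc (pz g a) m⇓ (ps g (a , x))

  nilᶜ : Comp A (list X) (λ _ _ → [])
  nilᶜ = zero by λ g a → zero

  nothingᶜ : Comp A (may X) (λ _ _ → nothing)
  nothingᶜ = zero by λ g a → zero

  consᶜ : ∀ {f h} → Comp A X f → Comp A (list X) h → Comp A (list X) (λ g a → f g a ∷ h g a)
  consᶜ (c by p) (d by q) = comp succ (pair c d) by λ g a → comp (pair (p g a) (q g a)) succ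

  justᶜ : ∀ {f} → Comp A X f → Comp A (may X) (λ g a → just (f g a))
  justᶜ (c by p) = comp succ c by λ g a → comp (p g a) succ

_∘ᶜ_ : ∀ {f h} → Comp B C f → Comp A B h → Comp A C (λ g a → f g (h g a))
_∘ᶜ_ = app

infixr 9 _∘ᶜ_

-- Comparisons, access to strings, and the coordinates of `⊕`

isZero : ℕ → Bool
isZero zero    = true
isZero (suc _) = false

leb eqb : ℕ → ℕ → Bool
leb m n = isZero (m ∸ n)
eqb m n = isZero ((m ∸ n) + (n ∸ m))

isZero-true : ∀ {n} → isZero n ≡ true → n ≡ 0
isZero-true {zero} _ = refl

leb-true : ∀ {m n} → leb m n ≡ true → m ≤ n
leb-true = m∸n≡0⇒m≤n ∘ isZero-true

leb-≤ : ∀ {m n} → m ≤ n → leb m n ≡ true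
leb-≤ m≤n = cong isZero (m≤n⇒m∸n≡0 m≤n)

eqb-true : ∀ {m n} → eqb m n ≡ true → m ≡ n
eqb-true {m} {n} eq = ≤-antisym
  (m∸n≡0⇒m≤n (m+n≡0⇒m≡0 (m ∸ n) (isZero-true eq)))
  (m∸n≡0⇒m≤n (m+n≡0⇒n≡0 (m ∸ n) (isZero-true eq)))

eqb-refl : ∀ n → eqb n n ≡ true
eqb-refl n rewrite n∸n≡0 n = refl

tail : {X : Set} → List X → List X
tail l = caseList l [] (λ _ xs → xs)

head : {X : Set} → List X → Maybe X
head l = caseList l nothing (λ x _ → just x)

nth : {X : Set} → List X → ℕ → Maybe X
nth l = head ∘ natrec l (λ _ → tail)

-- `natrec` unfolds on the outside, whereas recursion on a list treats the head first; this moves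
-- one step to the inside.
shift : ∀ {X : Set} {z : X} {f : X → X} n →
        natrec z (λ _ → f) (suc n) ≡ natrec (f z) (λ _ → f) n
shift zero            = refl
shift {f = f} (suc n) = cong f (shift n)

nth-suc : ∀ {X : Set} (x : X) xs i → nth (x ∷ xs) (suc i) ≡ nth xs i
nth-suc x xs i = cong head (shift i)

-- The padding by 0 is harmless: the tests below are guarded by lengths, and `parameters` is
-- evaluated on ever longer strings.
at : Str → Baire
at l i = fromMaybe 0 (nth l i)

-- halve i ≡ (⌊i/2⌋ , i is odd)
halve : ℕ → ℕ × Bool
halve = natrec (0 , false) (λ _ p → if proj₂ p then (suc (proj₁ p) , false) else (proj₁ p , true))

-- Unfolding `⊕` once exchanges its arguments, which matches the change of parity; the induction
-- therefore runs on the exchanged pair.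
⊕-halve : ∀ f g i → (f ⊕ g) i ≡ (if proj₂ (halve i) then g (proj₁ (halve i)) else f (proj₁ (halve i)))
⊕-halve f g zero    = refl
⊕-halve f g (suc i) with halve i | ⊕-halve g (f ∘ suc) i
... | h , false | eq = eq
... | h , true  | eq = eq

halve-bound : ∀ i → proj₁ (halve i) + proj₁ (halve i) + enc bool (proj₂ (halve i)) ≡ i
halve-bound zero    = refl
halve-bound (suc i) with halve i | halve-bound i
... | h , false | eq rewrite +-identityʳ (h + h) | +-comm (h + h) 1 = cong suc eq
... | h , true  | eq rewrite +-identityʳ (h + suc h) | +-suc h h | +-comm (h + h) 1 = cong suc eq

halve-< : ∀ {i m} → i < m + m → proj₁ (halve i) < m
halve-< {i} {m} i<m+m = ≰⇒> λ m≤h → <⇒≱ i<m+m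
  (≤-trans (+-mono-≤ m≤h m≤h)
    (≤-trans (m≤m+n _ (enc bool (proj₂ (halve i)))) (≤-reflexive (halve-bound i))))

↾-cong : ∀ {X : Set} {f f′ : ℕ → X} n → (∀ i → i < n → f i ≡ f′ i) → applyUpTo f n ≡ applyUpTo f′ n
↾-cong zero    eq = refl
↾-cong (suc n) eq = cong₂ _∷_ (eq 0 (s≤s z≤n)) (↾-cong n λ i i<n → eq (suc i) (s≤s i<n))

⊕-↾-cong : ∀ {f f′ g g′} m → (∀ i → i < m → f i ≡ f′ i) → (∀ i → i < m → g i ≡ g′ i) →
           (f ⊕ g) ↾ (m + m) ≡ (f′ ⊕ g′) ↾ (m + m)
⊕-↾-cong {f} {f′} {g} {g′} m eqf eqg = ↾-cong (m + m) λ i i< → begin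
  (f ⊕ g) i                                                        ≡⟨ ⊕-halve f g i ⟩
  (if proj₂ (halve i) then g (proj₁ (halve i)) else f (proj₁ (halve i)))
    ≡⟨ cong₂ (if proj₂ (halve i) then_else_) (eqg _ (halve-< i<)) (eqf _ (halve-< i<)) ⟩
  (if proj₂ (halve i) then g′ (proj₁ (halve i)) else f′ (proj₁ (halve i))) ≡⟨ ⊕-halve f′ g′ i ⟨
  (f′ ⊕ g′) i ∎
  where open ≡-Reasoning

-- Bounded quantification and programs for the basic operations

allBelow : ℕ → (ℕ → Bool) → Bool
allBelow n p = natrec true (λ k b → p k ∧ b) n

natᶜ : ∀ {f} → Comp A X f → Comp A nat (λ g a → enc X (f g a))
natᶜ c = relabel (λ _ _ → refl) ∘ᶜ c

infixr 6 _∧ᶜ_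
infixl 6 _∸ᶜ_ _+ᶜ_

_∧ᶜ_ : ∀ {f h} → Comp A bool f → Comp A bool h → Comp A bool (λ g a → f g a ∧ h g a)
_∧ᶜ_ {f = f} cf ch = extᶜ (ifᶜ cf ch (constᶜ false)) λ g a → lem (f g a)
  where
  lem : ∀ b {c} → (if b then c else false) ≡ b ∧ c
  lem false = refl
  lem true  = refl

notᶜ : ∀ {f} → Comp A bool f → Comp A bool (λ g a → not (f g a))
notᶜ {f = f} cf = extᶜ (ifᶜ cf (constᶜ false) (constᶜ true)) λ g a → lem (f g a)
  where
  lem : ∀ b → (if b then false else true) ≡ not b
  lem false = refl
  lem true  = refl

_∸ᶜ_ : ∀ {f h} → Comp A nat f → Comp A nat h → Comp A nat (λ g a → f g a ∸ h g a)
_∸ᶜ_ {f = f} {h} cf ch = extᶜ (natrecᶜ ch cf (predᶜ (snd ∘ᶜ snd))) λ g a → lem (f g a) (h g a)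
  where
  lem : ∀ m n → natrec m (λ _ → pred) n ≡ m ∸ n
  lem m zero    = refl
  lem m (suc n) = trans (cong pred (lem m n)) (pred[m∸n]≡m∸[1+n] m n)

_+ᶜ_ : ∀ {f h} → Comp A nat f → Comp A nat h → Comp A nat (λ g a → f g a + h g a)
_+ᶜ_ {f = f} {h} cf ch = extᶜ (natrecᶜ cf ch (sucᶜ (snd ∘ᶜ snd))) λ g a → lem (f g a) (h g a)
  where
  lem : ∀ m n → natrec n (λ _ → suc) m ≡ m + n
  lem zero    n = refl
  lem (suc m) n = cong suc (lem m n)

isZeroᶜ : ∀ {f} → Comp A nat f → Comp A bool (λ g a → isZero (f g a))
isZeroᶜ {f = f} cf = extᶜ (branchᶜ cf (constᶜ true) (constᶜ false)) λ g a → lem (f g a)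
  where
  lem : ∀ n → branch n true false ≡ isZero n
  lem zero    = refl
  lem (suc n) = refl

lebᶜ : ∀ {f h} → Comp A nat f → Comp A nat h → Comp A bool (λ g a → leb (f g a) (h g a))
lebᶜ cf ch = isZeroᶜ (cf ∸ᶜ ch)

eqbᶜ : ∀ {f h} → Comp A nat f → Comp A nat h → Comp A bool (λ g a → eqb (f g a) (h g a))
eqbᶜ cf ch = isZeroᶜ ((cf ∸ᶜ ch) +ᶜ (ch ∸ᶜ cf))

fromMaybeᶜ : ∀ {f m} → Comp A X f → Comp A (may X) m → Comp A X (λ g a → fromMaybe (f g a) (m g a))
fromMaybeᶜ {m = m} cf cm = extᶜ (maybeᶜ snd cf cm) λ g a → lem (m g a)
  where
  lem : ∀ {X : Set} {y : X} m → maybe id y m ≡ fromMaybe y m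
  lem nothing  = refl
  lem (just x) = refl

nthᶜ : ∀ {l i} → Comp A (list X) l → Comp A nat i → Comp A (may X) (λ g a → nth (l g a) (i g a))
nthᶜ cl ci = caseListᶜ (natrecᶜ ci cl (caseListᶜ (snd ∘ᶜ snd) nilᶜ (snd ∘ᶜ snd)))
  nothingᶜ (justᶜ (fst ∘ᶜ snd))

atᶜ : ∀ {l i} → Comp A (list nat) l → Comp A nat i → Comp A nat (λ g a → at (l g a) (i g a))
atᶜ cl ci = fromMaybeᶜ (constᶜ 0) (nthᶜ cl ci)

halveᶜ : ∀ {i} → Comp A nat i → Comp A (nat ⊠ bool) (λ g a → halve (i g a))
halveᶜ ci = natrecᶜ ci (constᶜ (0 , false))
  (ifᶜ (snd ∘ᶜ snd ∘ᶜ snd) (sucᶜ (fst ∘ᶜ snd ∘ᶜ snd) ,ᶜ constᶜ false) (fst ∘ᶜ snd ∘ᶜ snd ,ᶜ constᶜ true))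

-- The loop runs as often as the code of the list says, which is at least its length; once the list
-- is exhausted the remaining rounds are idle.
foldlᶜ : ∀ {s z l} → Comp (A ⊠ B ⊠ X) B s → Comp A B z → Comp A (list X) l →
         Comp A B (λ g a → foldl (λ b x → s g (a , b , x)) (z g a) (l g a))
foldlᶜ {A} {B} {X} {s} {z} {l} cs cz cl =
  extᶜ (fst ∘ᶜ natrecᶜ (natᶜ cl) (cz ,ᶜ cl)
         (caseListᶜ (snd ∘ᶜ snd ∘ᶜ snd) (snd ∘ᶜ snd)
           (cs ∘ᶜ (fst ∘ᶜ fst ,ᶜ fst ∘ᶜ snd ∘ᶜ snd ∘ᶜ fst ,ᶜ fst ∘ᶜ snd) ,ᶜ snd ∘ᶜ snd)))
    λ g a → lem g a (enc (list X) (l g a)) (z g a) (l g a) (length≤encList (enc X) (l g a))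
  where
  step : ∀ g a → ⟦ B ⟧ × List ⟦ X ⟧ → ⟦ B ⟧ × List ⟦ X ⟧
  step g a p = caseList (proj₂ p) p (λ x xs → s g (a , proj₁ p , x) , xs)
  lem : ∀ g a n b l → length l ≤ n →
        proj₁ (natrec (b , l) (λ _ → step g a) n) ≡ foldl (λ b x → s g (a , b , x)) b l
  lem g a zero    b []      _       = refl
  lem g a (suc n) b []      _       =
    trans (cong proj₁ (shift {f = step g a} n)) (lem g a n b [] z≤n)
  lem g a (suc n) b (x ∷ l) (s≤s p) =
    trans (cong proj₁ (shift {f = step g a} n)) (lem g a n _ l p)

lengthᶜ : ∀ {l} → Comp A (list X) l → Comp A nat (λ g a → length (l g a))
lengthᶜ {l = l} cl = extᶜ (foldlᶜ (sucᶜ (fst ∘ᶜ snd)) (constᶜ 0) cl) λ g a → lem 0 (l g a)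
  where
  lem : ∀ {X : Set} n (l : List X) → foldl (λ n _ → suc n) n l ≡ n + length l
  lem n []      = sym (+-identityʳ n)
  lem n (x ∷ l) = trans (lem (suc n) l) (sym (+-suc n (length l)))

infixr 5 _++ᶜ_

-- One fold reverses the first list, and a second one pushes it back onto the other list.
_++ᶜ_ : ∀ {f h} → Comp A (list X) f → Comp A (list X) h → Comp A (list X) (λ g a → f g a ++ h g a)
_++ᶜ_ {f = f} {h} cf ch =
  extᶜ (foldlᶜ push ch (foldlᶜ push nilᶜ cf)) λ g a → lem (f g a) (h g a)
  where
  push : Comp (B ⊠ list C ⊠ C) (list C) (λ _ p → proj₂ (proj₂ p) ∷ proj₁ (proj₂ p))
  push = consᶜ (snd ∘ᶜ snd) (fst ∘ᶜ snd)
  lem : ∀ {X : Set} (xs ys : List X) → reverse xs ʳ++ ys ≡ xs ++ ys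
  lem xs ys = trans (ʳ++-defn (reverse xs)) (cong (_++ ys) (reverse-involutive xs))

-- Consing builds the list from its end, so round `j` contributes the entry at `n ∸ suc j`.
applyUpToᶜ : ∀ {f n} → Comp (A ⊠ nat) X f → Comp A nat n →
             Comp A (list X) (λ g a → applyUpTo (λ i → f g (a , i)) (n g a))
applyUpToᶜ {A} {X} {f} {n} cf cn =
  extᶜ (natrecᶜ cn nilᶜ
         (consᶜ (cf ∘ᶜ (fst ,ᶜ wk cn ∸ᶜ sucᶜ (fst ∘ᶜ snd))) (snd ∘ᶜ snd)))
    λ g a → trans (lem (λ i → f g (a , i)) (n g a) (n g a) ≤-refl)
                  (↾-cong (n g a) λ i _ → cong (λ k → f g (a , k + i)) (n∸n≡0 (n g a)))
  where
  lem : ∀ {X : Set} (f : ℕ → X) n k → k ≤ n →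
        natrec [] (λ j l → f (n ∸ suc j) ∷ l) k ≡ applyUpTo (λ i → f (n ∸ k + i)) k
  lem f n zero    _ = refl
  lem f n (suc k) k<n = cong₂ _∷_ (cong f (sym (+-identityʳ _)))
    (trans (lem f n k (<⇒≤ k<n)) (↾-cong k λ i _ → cong f
      (trans (cong (_+ i) (+-∸-assoc 1 k<n)) (sym (+-suc (n ∸ suc k) i)))))

allBelowᶜ : ∀ {p n} → Comp (A ⊠ nat) bool p → Comp A nat n →
            Comp A bool (λ g a → allBelow (n g a) (λ k → p g (a , k)))
allBelowᶜ cp cn = natrecᶜ cn (constᶜ true) (cp ∘ᶜ (fst ,ᶜ fst ∘ᶜ snd) ∧ᶜ snd ∘ᶜ snd)

∧-true : ∀ {a b} → a ∧ b ≡ true → a ≡ true × b ≡ true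
∧-true {true} {true} _ = refl , refl

not-true : ∀ {a} → not a ≡ true → a ≡ false
not-true {false} _ = refl

allBelow-true : ∀ {p} n → (∀ k → p k ≡ true) → allBelow n p ≡ true
allBelow-true zero    h = refl
allBelow-true (suc n) h rewrite h n = allBelow-true n h

allBelow-elim : ∀ {p} n → allBelow n p ≡ true → ∀ {k} → k < n → p k ≡ true
allBelow-elim {p} (suc n) h {k} k<1+n with k ≟ n | ∧-true h
... | yes refl | q , _ = q
... | no  k≢n  | _ , q = allBelow-elim n q (≤∧≢⇒< (≤-pred k<1+n) k≢n)

-- An interpreter for codes with partial oracles

frameT configT stateT : Ty
frameT  = nat ⊠ code ⊠ nat ⊠ nat
configT = may code ⊠ nat ⊠ list frameT
stateT  = may configT

Frame Config State : Set
Frame  = ⟦ frameT ⟧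
Config = ⟦ configT ⟧
State  = ⟦ stateT ⟧

-- ev c x k evaluates c at x, and ret v k passes the value v to the
-- continuation k.
ev : Code → ℕ → List Frame → State
ev c x k = just (just c , x , k)

ret : ℕ → List Frame → State
ret v k = just (nothing , v , k)

-- As `Ty` has no sums, a frame is a tag followed by a code and two numbers; idle slots hold `zero`
-- or 0.
pattern pairLeft d x   = 0 , d , x , 0
pattern pairRight y    = 1 , zero , y , 0
pattern compFrame c    = 2 , c , 0 , 0
pattern precFrame d a n = 3 , d , a , n
pattern muFrame c a n  = 4 , c , a , n

view : Code → ℕ × Code × Code
view zero       = 0 , zero , zero
view succ       = 1 , zero , zero
view left       = 2 , zero , zero
view right      = 3 , zero , zero
view oracle     = 4 , zero , zero
view (pair c d) = 5 , c , d
view (comp c d) = 6 , c , d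
view (prec c d) = 7 , c , d
view (mu c)     = 8 , c , zero

-- `t ∸ i` vanishes for all `t ≤ i`, but smaller tags have been caught by the preceding branches. A
-- missing oracle answer stops the machine for good.
evalStep : Maybe ℕ → Code → ℕ → List Frame → State
evalStep o c x k =
  branch t         (ret 0 k)
  (branch (t ∸ 1)  (ret (suc x) k)
  (branch (t ∸ 2)  (ret (proj₁ (unpair x)) k)
  (branch (t ∸ 3)  (ret (proj₂ (unpair x)) k)
  (branch (t ∸ 4)  (maybe (λ v → ret v k) nothing o)
  (branch (t ∸ 5)  (ev c₁ x (pairLeft c₂ x ∷ k))
  (branch (t ∸ 6)  (ev c₂ x (compFrame c₁ ∷ k))
  (branch (t ∸ 7)  (caseℕ (proj₂ (unpair x)) (ev c₁ (proj₁ (unpair x)) k)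
                     (λ n → ev c ⟨ proj₁ (unpair x) , n ⟩ (precFrame c₂ (proj₁ (unpair x)) n ∷ k)))
                   (ev c₁ ⟨ x , 0 ⟩ (muFrame c₁ x 0 ∷ k)))))))))
  where
  t : ℕ
  t  = proj₁ (view c)
  c₁ c₂ : Code
  c₁ = proj₁ (proj₂ (view c))
  c₂ = proj₂ (proj₂ (view c))

returnStep : ℕ → Frame → List Frame → State
returnStep v (t , d , a , n) k =
  branch t        (ev d a (pairRight v ∷ k))
  (branch (t ∸ 1) (ret ⟨ a , v ⟩ k)
  (branch (t ∸ 2) (ev d v k)
  (branch (t ∸ 3) (ev d ⟨ a , ⟨ n , v ⟩ ⟩ k)
                  (branch v (ret n k) (ev d ⟨ a , suc n ⟩ (muFrame d a (suc n) ∷ k))))))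

-- The first argument is the answer of the oracle to the query v.
step : Maybe ℕ → Config → State
step o (m , v , k) =
  maybe (λ c → evalStep o c v k) (caseList k (ret v []) (returnStep v)) m

run : (ℕ → Maybe ℕ) → ℕ → State → State
run o t s = natrec s (λ _ → maybe (λ q → step (o (proj₁ (proj₂ q))) q) nothing) t

outcome : State → Maybe ℕ
outcome = maybe
  (λ (m , v , k) → maybe (λ _ → nothing) (caseList k (just v) (λ _ _ → nothing)) m) nothing

∸-const : ∀ {f} m → Comp A nat f → Comp A nat (λ g a → f g a ∸ m)
∸-const m cf = cf ∸ᶜ constᶜ m

pairNatᶜ : ∀ {f h} → Comp A nat f → Comp A nat h → Comp A nat (λ g a → ⟨ f g a , h g a ⟩)
pairNatᶜ cf ch = natᶜ {X = nat ⊠ nat} (cf ,ᶜ ch)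

unpairᶜ : ∀ {f} → Comp A nat f → Comp A (nat ⊠ nat) (λ g a → unpair (f g a))
unpairᶜ cf = relabel {nat} {nat ⊠ nat} {λ _ → unpair} (λ _ a → sym (⟨⟩-unpair a)) ∘ᶜ cf

-- Unpairing `# c` yields its tag and components. The tags 1, 2, 3 of `#` become 5, 6, 7, and the
-- filler `zero` is the number 0.
viewᶜ : ∀ {f} → Comp A code f → Comp A (nat ⊠ code ⊠ code) (λ g a → view (f g a))
viewᶜ cf = castᶜ {D = nat ⊠ code ⊠ code} {f′ = λ _ → view} num # (λ _ → refl) (λ _ → lem) ∘ᶜ cf
  where
  viewNum : ℕ → ℕ × ℕ × ℕ
  viewNum e = let (t , p) = unpair e in
    branch t (p , 0 , 0) (branch (t ∸ 3) (4 + t , unpair p) (8 , p , 0))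
  num : Comp nat (nat ⊠ nat ⊠ nat) (λ _ → viewNum)
  num = branchᶜ (fst ∘ᶜ u) (snd ∘ᶜ u ,ᶜ constᶜ (0 , 0))
    (branchᶜ (∸-const 3 (fst ∘ᶜ u)) (constᶜ 4 +ᶜ fst ∘ᶜ u ,ᶜ unpairᶜ (snd ∘ᶜ u))
      (constᶜ 8 ,ᶜ snd ∘ᶜ u ,ᶜ constᶜ 0))
    where
    u : Comp nat (nat ⊠ nat) (λ _ → unpair)
    u = unpairᶜ idᶜ
  lem : ∀ c → enc (nat ⊠ nat ⊠ nat) (viewNum (# c)) ≡ enc (nat ⊠ code ⊠ code) (view c)
  lem zero       rewrite unpair-⟨⟩ 0 0 = refl
  lem succ       rewrite unpair-⟨⟩ 0 1 = refl
  lem left       rewrite unpair-⟨⟩ 0 2 = refl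
  lem right      rewrite unpair-⟨⟩ 0 3 = refl
  lem oracle     rewrite unpair-⟨⟩ 0 4 = refl
  lem (pair c d) rewrite unpair-⟨⟩ 1 ⟨ # c , # d ⟩ | unpair-⟨⟩ (# c) (# d) = refl
  lem (comp c d) rewrite unpair-⟨⟩ 2 ⟨ # c , # d ⟩ | unpair-⟨⟩ (# c) (# d) = refl
  lem (prec c d) rewrite unpair-⟨⟩ 3 ⟨ # c , # d ⟩ | unpair-⟨⟩ (# c) (# d) = refl
  lem (mu c)     rewrite unpair-⟨⟩ 4 (# c) = refl

evᶜ : ∀ {f h k} → Comp A code f → Comp A nat h → Comp A (list frameT) k →
      Comp A stateT (λ g a → ev (f g a) (h g a) (k g a))
evᶜ cf ch ck = justᶜ (justᶜ cf ,ᶜ ch ,ᶜ ck)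

retᶜ : ∀ {h k} → Comp A nat h → Comp A (list frameT) k → Comp A stateT (λ g a → ret (h g a) (k g a))
retᶜ ch ck = justᶜ (nothingᶜ ,ᶜ ch ,ᶜ ck)

evalStepᶜ : Comp (may nat ⊠ code ⊠ nat ⊠ list frameT) stateT
              (λ _ (o , c , x , k) → evalStep o c x k)
evalStepᶜ =
  branchᶜ t              (retᶜ (constᶜ 0) k)
  (branchᶜ (∸-const 1 t) (retᶜ (sucᶜ x) k)
  (branchᶜ (∸-const 2 t) (retᶜ x₁ k)
  (branchᶜ (∸-const 3 t) (retᶜ x₂ k)
  (branchᶜ (∸-const 4 t) (maybeᶜ (retᶜ snd (wk k)) nothingᶜ fst)
  (branchᶜ (∸-const 5 t) (evᶜ c₁ x (consᶜ (constᶜ 0 ,ᶜ c₂ ,ᶜ x ,ᶜ constᶜ 0) k))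
  (branchᶜ (∸-const 6 t) (evᶜ c₂ x (consᶜ (constᶜ 2 ,ᶜ c₁ ,ᶜ constᶜ 0 ,ᶜ constᶜ 0) k))
  (branchᶜ (∸-const 7 t) (caseᶜ x₂ (evᶜ c₁ x₁ k)
                           (evᶜ (wk c) (pairNatᶜ (wk x₁) snd)
                             (consᶜ (constᶜ 3 ,ᶜ wk c₂ ,ᶜ wk x₁ ,ᶜ snd) (wk k))))
                         (evᶜ c₁ (pairNatᶜ x (constᶜ 0))
                           (consᶜ (constᶜ 4 ,ᶜ c₁ ,ᶜ x ,ᶜ constᶜ 0) k)))))))))
  where
  Env : Ty
  Env = may nat ⊠ code ⊠ nat ⊠ list frameT
  c : Comp Env code (λ _ p → proj₁ (proj₂ p))
  c = fst ∘ᶜ snd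
  x : Comp Env nat (λ _ p → proj₁ (proj₂ (proj₂ p)))
  x = fst ∘ᶜ snd ∘ᶜ snd
  k : Comp Env (list frameT) (λ _ p → proj₂ (proj₂ (proj₂ p)))
  k = snd ∘ᶜ snd ∘ᶜ snd
  x₁ : Comp Env nat (λ _ p → proj₁ (unpair (proj₁ (proj₂ (proj₂ p)))))
  x₁ = fst ∘ᶜ unpairᶜ x
  x₂ : Comp Env nat (λ _ p → proj₂ (unpair (proj₁ (proj₂ (proj₂ p)))))
  x₂ = snd ∘ᶜ unpairᶜ x
  t : Comp Env nat (λ _ p → proj₁ (view (proj₁ (proj₂ p))))
  t = fst ∘ᶜ viewᶜ c
  c₁ : Comp Env code (λ _ p → proj₁ (proj₂ (view (proj₁ (proj₂ p)))))
  c₁ = fst ∘ᶜ snd ∘ᶜ viewᶜ c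
  c₂ : Comp Env code (λ _ p → proj₂ (proj₂ (view (proj₁ (proj₂ p)))))
  c₂ = snd ∘ᶜ snd ∘ᶜ viewᶜ c

returnStepᶜ : Comp (nat ⊠ frameT ⊠ list frameT) stateT (λ _ (v , f , k) → returnStep v f k)
returnStepᶜ =
  branchᶜ t              (evᶜ d a (consᶜ (constᶜ 1 ,ᶜ constᶜ zero ,ᶜ v ,ᶜ constᶜ 0) k))
  (branchᶜ (∸-const 1 t) (retᶜ (pairNatᶜ a v) k)
  (branchᶜ (∸-const 2 t) (evᶜ d v k)
  (branchᶜ (∸-const 3 t) (evᶜ d (pairNatᶜ a (pairNatᶜ n v)) k)
                         (branchᶜ v (retᶜ n k)
                           (evᶜ d (pairNatᶜ a (sucᶜ n))
                             (consᶜ (constᶜ 4 ,ᶜ d ,ᶜ a ,ᶜ sucᶜ n) k))))))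
  where
  Env : Ty
  Env = nat ⊠ frameT ⊠ list frameT
  v : Comp Env nat (λ _ → proj₁)
  v = fst
  k : Comp Env (list frameT) (λ _ p → proj₂ (proj₂ p))
  k = snd ∘ᶜ snd
  t : Comp Env nat (λ _ p → proj₁ (proj₁ (proj₂ p)))
  t = fst ∘ᶜ fst ∘ᶜ snd
  d : Comp Env code (λ _ p → proj₁ (proj₂ (proj₁ (proj₂ p))))
  d = fst ∘ᶜ snd ∘ᶜ fst ∘ᶜ snd
  a : Comp Env nat (λ _ p → proj₁ (proj₂ (proj₂ (proj₁ (proj₂ p)))))
  a = fst ∘ᶜ snd ∘ᶜ snd ∘ᶜ fst ∘ᶜ snd
  n : Comp Env nat (λ _ p → proj₂ (proj₂ (proj₂ (proj₁ (proj₂ p)))))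
  n = snd ∘ᶜ snd ∘ᶜ snd ∘ᶜ fst ∘ᶜ snd

stepᶜ : Comp (may nat ⊠ configT) stateT (λ _ p → step (proj₁ p) (proj₂ p))
stepᶜ = maybeᶜ (evalStepᶜ ∘ᶜ (fst ∘ᶜ fst ,ᶜ snd ,ᶜ snd ∘ᶜ snd ∘ᶜ fst))
  (caseListᶜ (snd ∘ᶜ snd ∘ᶜ snd) (retᶜ (fst ∘ᶜ snd ∘ᶜ snd) nilᶜ)
    (returnStepᶜ ∘ᶜ (fst ∘ᶜ snd ∘ᶜ snd ∘ᶜ fst ,ᶜ snd)))
  (fst ∘ᶜ snd)

runᶜ : ∀ {o t s} → Comp (A ⊠ nat) (may nat) o → Comp A nat t → Comp A stateT s →
       Comp A stateT (λ g a → run (λ x → o g (a , x)) (t g a) (s g a))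
runᶜ co ct cs = natrecᶜ ct cs
  (maybeᶜ (stepᶜ ∘ᶜ (co ∘ᶜ (fst ∘ᶜ fst ,ᶜ fst ∘ᶜ snd ∘ᶜ snd) ,ᶜ snd)) nothingᶜ (snd ∘ᶜ snd))

outcomeᶜ : ∀ {s} → Comp A stateT s → Comp A (may nat) (λ g a → outcome (s g a))
outcomeᶜ cs = maybeᶜ (maybeᶜ nothingᶜ
    (caseListᶜ (snd ∘ᶜ snd ∘ᶜ snd) (justᶜ (fst ∘ᶜ snd ∘ᶜ snd)) nothingᶜ) (fst ∘ᶜ snd))
  nothingᶜ cs

Reaches : (ℕ → Maybe ℕ) → State → State → Set
Reaches o s s′ = ∃[ t ] run o t s ≡ s′

run-+ : ∀ o m n s → run o (m + n) s ≡ run o m (run o n s)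
run-+ o zero    n s = refl
run-+ o (suc m) n s rewrite run-+ o m n s = refl

module Machine (o : ℕ → Maybe ℕ) where

  infixr 5 _⨾_

  _⨾_ : ∀ {s s′ s″} → Reaches o s s′ → Reaches o s′ s″ → Reaches o s s″
  _⨾_ {s} (m , refl) (n , refl) = n + m , run-+ o n m s

  one : ∀ {q s} → step (o (proj₁ (proj₂ q))) q ≡ s → Reaches o (just q) s
  one eq = 1 , eq

run-halted : ∀ o v n → run o n (ret v []) ≡ ret v []
run-halted o v zero    = refl
run-halted o v (suc n) rewrite run-halted o v n = refl

module _ {f : Baire} where

  private
    o : ℕ → Maybe ℕ
    o = just ∘ f

  open Machine o

  -- The continuation is arbitrary so that the runs of subprograms can be chained.
  machine-complete : ∀ {c x y} → f ⊢ c · x ⇓ y → ∀ k → Reaches o (ev c x k) (ret y k)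
  -- Here `i` is the argument under test and `j` the number of failures still to come.
  mu-loop : ∀ {c a n} → f ⊢ c · ⟨ a , n ⟩ ⇓ 0 → (∀ m → m < n → ∃[ k ] f ⊢ c · ⟨ a , m ⟩ ⇓ suc k) →
            ∀ j i → j + i ≡ n → ∀ k → Reaches o (ev c ⟨ a , i ⟩ (muFrame c a i ∷ k)) (ret n k)

  machine-complete zero   k = one refl
  machine-complete succ   k = one refl
  machine-complete (left {a} {b}) k = one (cong (λ p → ret (proj₁ p) k) (unpair-⟨⟩ a b))
  machine-complete (right {a} {b}) k = one (cong (λ p → ret (proj₂ p) k) (unpair-⟨⟩ a b))
  machine-complete oracle k = one refl
  machine-complete (pair {d = d} {x = x} {y} p q) k =
    one refl ⨾ machine-complete p (pairLeft d x ∷ k) ⨾ one refl ⨾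
    machine-complete q (pairRight y ∷ k) ⨾ one refl
  machine-complete (comp {c = c} p q) k =
    one refl ⨾ machine-complete p (compFrame c ∷ k) ⨾ one refl ⨾ machine-complete q k
  machine-complete (prec-zero {c} {d} {a} p) k =
    one (cong (λ p → caseℕ (proj₂ p) (ev c (proj₁ p) k)
                (λ m → ev (prec c d) ⟨ proj₁ p , m ⟩ (precFrame d (proj₁ p) m ∷ k)))
              (unpair-⟨⟩ a 0)) ⨾
    machine-complete p k
  machine-complete (prec-suc {c} {d} {a} {n} p q) k =
    one (cong (λ p → caseℕ (proj₂ p) (ev c (proj₁ p) k)
                (λ m → ev (prec c d) ⟨ proj₁ p , m ⟩ (precFrame d (proj₁ p) m ∷ k)))
              (unpair-⟨⟩ a (suc n))) ⨾
    machine-complete p (precFrame d a n ∷ k) ⨾ one refl ⨾ machine-complete q k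
  machine-complete (mu {c} {a} {n} p q) k = one refl ⨾ mu-loop p q n 0 (+-identityʳ n) k

  mu-loop {c} {a} p q zero    i refl k = machine-complete p (muFrame c a i ∷ k) ⨾ one refl
  mu-loop {c} {a} p q (suc j) i eq   k =
    machine-complete (proj₂ (q i i<n)) (muFrame c a i ∷ k) ⨾ one refl ⨾
    mu-loop p q j (suc i) (trans (+-suc j i) eq) k
    where
    i<n = ≤-trans (s≤s (m≤n+m i j)) (≤-reflexive eq)

ret-injective : ∀ {v v′ k k′} → ret v k ≡ ret v′ k′ → v ≡ v′
ret-injective refl = refl

outcome-just : ∀ s {v} → outcome s ≡ just v → s ≡ ret v []
outcome-just (just (nothing , v , [])) refl = refl

run-cong : ∀ {o o′} → (∀ x → o x ≡ o′ x) → ∀ t s → run o t s ≡ run o′ t s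
run-cong {o} {o′} eq zero    s = refl
run-cong {o} {o′} eq (suc t) s rewrite run-cong eq t s with run o′ t s
... | nothing = refl
... | just q  = cong (λ a → step a q) (eq _)

halted-later : ∀ o {t t′ s v} → run o t s ≡ ret v [] → t ≤ t′ → run o t′ s ≡ ret v []
halted-later o {t} {t′} {s} {v} eq t≤t′ = begin
  run o t′ s               ≡⟨ cong (λ k → run o k s) (sym (m∸n+n≡m t≤t′)) ⟩
  run o (t′ ∸ t + t) s     ≡⟨ run-+ o (t′ ∸ t) t s ⟩
  run o (t′ ∸ t) (run o t s) ≡⟨ cong (run o (t′ ∸ t)) eq ⟩
  run o (t′ ∸ t) (ret v []) ≡⟨ run-halted o v (t′ ∸ t) ⟩
  ret v []                 ∎
  where open ≡-Reasoning

halted-unique : ∀ o {t t′ s v v′} → run o t s ≡ ret v [] → run o t′ s ≡ ret v′ [] → v ≡ v′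
halted-unique o {t} {t′} p q with ≤-total t t′
... | inj₁ t≤t′ = ret-injective (trans (sym (halted-later o {t} {t′} p t≤t′)) q)
... | inj₂ t′≤t = ret-injective (trans (sym p) (halted-later o {t′} {t} q t′≤t))

-- Both derivations are traced by the same deterministic machine, which stays put once it has
-- halted.
⇓-deterministic : ∀ {f f′ c x y y′} → f ≗ f′ → f ⊢ c · x ⇓ y → f′ ⊢ c · x ⇓ y′ → y ≡ y′
⇓-deterministic {f} {f′} {c} {x} eq p q with machine-complete p [] | machine-complete q []
... | t , r | t′ , r′ =
  halted-unique (just ∘ f′) {t} {t′} {ev c x []}
    (trans (sym (run-cong (λ x → cong just (eq x)) t (ev c x []))) r) r′

-- The use principle: computing from an initial segment of the oracle

infix 4 _◁_

_◁_ : Str → Baire → Set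
σ ◁ f = ∀ i v → nth σ i ≡ just v → v ≡ f i

Covers : Baire → ℕ → Str → Set
Covers f m σ = ∀ i → i < m → nth σ i ≡ just (f i)

-- The oracle f ⊕ γ, where only the initial segment u of f is known.
partialOracle : Str → Baire → ℕ → Maybe ℕ
partialOracle u γ x = if proj₂ (halve x) then just (γ (proj₁ (halve x))) else nth u (proj₁ (halve x))

module _ {u : Str} {f γ : Baire} where

  partialOracle-sound : u ◁ f → ∀ x →
    partialOracle u γ x ≡ nothing ⊎ partialOracle u γ x ≡ just ((f ⊕ γ) x)
  partialOracle-sound u◁f x rewrite ⊕-halve f γ x with halve x
  ... | h , true  = inj₂ refl
  ... | h , false with nth u h in eq
  ...   | nothing = inj₁ refl
  ...   | just v  = inj₂ (cong just (u◁f h v eq))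

-- The machine offers an oracle answer at every step, but only the program `oracle` looks at it.
step-mono : ∀ q → step nothing q ≡ nothing ⊎ (∀ a → step nothing q ≡ step a q)
step-mono (nothing       , v , k) = inj₂ λ _ → refl
step-mono (just zero     , v , k) = inj₂ λ _ → refl
step-mono (just succ     , v , k) = inj₂ λ _ → refl
step-mono (just left     , v , k) = inj₂ λ _ → refl
step-mono (just right    , v , k) = inj₂ λ _ → refl
step-mono (just oracle   , v , k) = inj₁ refl
step-mono (just (pair _ _) , v , k) = inj₂ λ _ → refl
step-mono (just (comp _ _) , v , k) = inj₂ λ _ → refl
step-mono (just (prec _ _) , v , k) = inj₂ λ _ → refl
step-mono (just (mu _)   , v , k) = inj₂ λ _ → refl

run-sound : ∀ {u f γ} → u ◁ f → ∀ t s →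
  run (partialOracle u γ) t s ≡ nothing ⊎ run (partialOracle u γ) t s ≡ run (just ∘ (f ⊕ γ)) t s
run-sound u◁f zero s = inj₂ refl
run-sound {u} {f} {γ} u◁f (suc t) s
  with run (partialOracle u γ) t s | run (just ∘ (f ⊕ γ)) t s | run-sound {u} {f} {γ} u◁f t s
... | _ | _ | inj₁ refl = inj₁ refl
... | _ | nothing | inj₂ refl = inj₁ refl
... | _ | just q | inj₂ refl with partialOracle-sound {u} {f} {γ} u◁f (proj₁ (proj₂ q))
...   | inj₂ eq = inj₂ (cong (λ a → step a q) eq)
...   | inj₁ eq rewrite eq with step-mono q
...     | inj₁ eq′ = inj₁ eq′
...     | inj₂ eq′ = inj₂ (eq′ _)

-- A step reads at most one position of the oracle, so the use is enlarged by that position, halved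
-- because `f` occupies the even places.
run-continuous : ∀ f γ t s → ∃[ m ] (∀ u → Covers f m u →
  run (partialOracle u γ) t s ≡ run (just ∘ (f ⊕ γ)) t s)
run-continuous f γ zero    s = 0 , λ _ _ → refl
run-continuous f γ (suc t) s = m ⊔ suc h , go
  where
  m = proj₁ (run-continuous f γ t s)
  r = run (just ∘ (f ⊕ γ)) t s
  h = proj₁ (halve (maybe (λ q → proj₁ (proj₂ q)) 0 r))
  go : ∀ u → Covers f (m ⊔ suc h) u →
       run (partialOracle u γ) (suc t) s ≡ run (just ∘ (f ⊕ γ)) (suc t) s
  go u cov rewrite proj₂ (run-continuous f γ t s) u (λ i i< → cov i (≤-trans i< (m≤m⊔n m _)))
    with r | cov h (m≤n⊔m m _)
  ... | nothing | _   = refl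
  ... | just q  | eq  = cong (λ a → step a q) (lem (proj₁ (proj₂ q)) eq)
    where
    lem : ∀ x → nth u (proj₁ (halve x)) ≡ just (f (proj₁ (halve x))) →
          partialOracle u γ x ≡ just ((f ⊕ γ) x)
    lem x eq rewrite ⊕-halve f γ x with halve x
    ... | h , true  = refl
    ... | h , false = eq

eval : Baire → ℕ → Code → Str → ℕ → Maybe ℕ
eval γ t c u j = outcome (run (partialOracle u γ) t (ev c j []))

module _ {f γ : Baire} {c : Code} {j v : ℕ} (p : f ⊕ γ ⊢ c · j ⇓ v) where

  eval-sound : ∀ {u} t → u ◁ f → ∀ {v′} → eval γ t c u j ≡ just v′ → v′ ≡ v
  eval-sound {u} t u◁f eq with outcome-just _ eq | run-sound {u} {f} {γ} u◁f t (ev c j []) | machine-complete p []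
  ... | eq′ | inj₁ r | _       with () ← trans (sym eq′) r
  ... | eq′ | inj₂ r | t′ , r′ = halted-unique (just ∘ (f ⊕ γ)) {t} {t′} {ev c j []} (trans (sym r) eq′) r′

  eval-complete : ∃[ m ] ∃[ T ] (∀ t → T ≤ t → ∀ u → Covers f m u → eval γ t c u j ≡ just v)
  eval-complete with machine-complete p []
  ... | T , r with run-continuous f γ T (ev c j [])
  ...   | m , cont = m , T , λ t T≤t u cov →
    cong outcome (halted-later (partialOracle u γ) {T} {t} {ev c j []} (trans (cont u cov) r) T≤t)

-- The values at 0, 1, 2, … that can be computed in t steps from u.
output : Baire → ℕ → Code → Str → Str
output γ t c u =
  natrec [] (λ _ σ → maybe (λ v → σ ++ v ∷ []) σ (eval γ t c u (length σ))) t

nth-[] : ∀ {X : Set} i → nth {X} [] i ≡ nothing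
nth-[] zero    = refl
nth-[] (suc i) = trans (cong head (shift {z = []} {tail} i)) (nth-[] i)

nth-++ˡ : ∀ {X : Set} (σ τ : List X) {i v} → nth σ i ≡ just v → nth (σ ++ τ) i ≡ just v
nth-++ˡ []      τ {i} eq with () ← trans (sym (nth-[] i)) eq
nth-++ˡ (x ∷ σ) τ {zero}  eq = eq
nth-++ˡ (x ∷ σ) τ {suc i} eq =
  trans (nth-suc x (σ ++ τ) i) (nth-++ˡ σ τ {i} (trans (sym (nth-suc x σ i)) eq))

nth-snoc : ∀ {X : Set} (σ : List X) x {i v} → nth (σ ++ x ∷ []) i ≡ just v →
           nth σ i ≡ just v ⊎ (i ≡ length σ × v ≡ x)
nth-snoc []      x {zero}  refl = inj₂ (refl , refl)
nth-snoc []      x {suc i} eq with () ← trans (sym (trans (nth-suc x [] i) (nth-[] i))) eq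
nth-snoc (y ∷ σ) x {zero}  eq = inj₁ eq
nth-snoc (y ∷ σ) x {suc i} eq with nth-snoc σ x {i} (trans (sym (nth-suc y (σ ++ x ∷ []) i)) eq)
... | inj₁ eq′          = inj₁ (trans (nth-suc y σ i) eq′)
... | inj₂ (refl , eq′) = inj₂ (refl , eq′)

nth-applyUpTo : ∀ {X : Set} (f : ℕ → X) n {i} → i < n → nth (applyUpTo f n) i ≡ just (f i)
nth-applyUpTo f (suc n) {zero}  _         = refl
nth-applyUpTo f (suc n) {suc i} (s≤s i<n) =
  trans (nth-suc (f 0) (applyUpTo (f ∘ suc) n) i) (nth-applyUpTo (f ∘ suc) n i<n)

[]-◁ : ∀ {f} → [] ◁ f
[]-◁ {f} i v eq with () ← trans (sym (nth-[] i)) eq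

module _ {f γ h : Baire} {c : Code} (p : ∀ n → f ⊕ γ ⊢ c · n ⇓ h n) where

  output-sound : ∀ {u} t → u ◁ f → output γ t c u ◁ h
  output-sound {u} t u◁f = go t
    where
    go : ∀ k → natrec [] (λ _ σ → maybe (λ v → σ ++ v ∷ []) σ (eval γ t c u (length σ))) k ◁ h
    go zero = []-◁
    go (suc k) i v eq with natrec [] (λ _ σ → maybe (λ v → σ ++ v ∷ []) σ (eval γ t c u (length σ))) k | go k
    ... | σ | σ◁h with eval γ t c u (length σ) in eq′
    ...   | nothing = σ◁h i v eq
    ...   | just v′ with nth-snoc σ v′ {i} eq
    ...     | inj₁ eq″          = σ◁h i v eq″
    ...     | inj₂ (refl , refl) = eval-sound (p (length σ)) {u} t u◁f eq′

  private
    uniformly : ∀ n → ∃[ m ] ∃[ T ] (∀ t → T ≤ t → ∀ u → Covers f m u →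
                  ∀ {j} → j < n → eval γ t c u j ≡ just (h j))
    uniformly zero = 0 , 0 , λ _ _ _ _ ()
    uniformly (suc n) with uniformly n | eval-complete (p n)
    ... | m , T , r | m′ , T′ , r′ = m ⊔ m′ , T ⊔ T′ , go
      where
      go : ∀ t → T ⊔ T′ ≤ t → ∀ u → Covers f (m ⊔ m′) u →
           ∀ {j} → j < suc n → eval γ t c u j ≡ just (h j)
      go t T≤t u cov {j} j≤n with j ≟ n
      ... | yes refl = r′ t (m⊔n≤o⇒n≤o T T′ T≤t) u (λ i i< → cov i (≤-trans i< (m≤n⊔m m m′)))
      ... | no  j≢n  = r t (m⊔n≤o⇒m≤o T T′ T≤t) u (λ i i< → cov i (≤-trans i< (m≤m⊔n m m′)))
                         (≤∧≢⇒< (≤-pred j≤n) j≢n)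

  output-complete : ∀ n → ∃[ m ] ∃[ T ] (∀ t → T ≤ t → ∀ u → Covers f m u → Covers h n (output γ t c u))
  output-complete n with uniformly n
  -- The same `t` bounds each single evaluation and the number of rounds; `n` rounds are needed to
  -- append `n` values.
  ... | m , T , r = m , T ⊔ n , λ t T≤t u cov →
    covers t u (r t (m⊔n≤o⇒m≤o T n T≤t) u cov) t (m⊔n≤o⇒n≤o T n T≤t)
    where
    module _ t u (val : ∀ {j} → j < n → eval γ t c u j ≡ just (h j)) where
      W : ℕ → Str
      W = natrec [] (λ _ σ → maybe (λ v → σ ++ v ∷ []) σ (eval γ t c u (length σ)))
      exact : ∀ k → k ≤ n → W k ≡ h ↾ k
      exact zero    _ = refl
      exact (suc k) k<n rewrite exact k (<⇒≤ k<n) | length-applyUpTo h k | val k<n = applyUpTo-∷ʳ h k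
      covers : ∀ k → n ≤ k → Covers h n (W k)
      covers k n≤k i i<n with m≤n⇒m<n∨m≡n n≤k
      ... | inj₂ refl rewrite exact n ≤-refl = nth-applyUpTo h n i<n
      covers (suc k) n≤k i i<n | inj₁ (s≤s n≤k′) with covers k n≤k′ i i<n
      ... | eq with eval γ t c u (length (W k))
      ...   | nothing = eq
      ...   | just v  = nth-++ˡ (W k) _ {i} eq

-- Injectivity of the numbering of codes

decode : ℕ → ℕ → Code
decode zero    e = zero
decode (suc k) e = let (t , p) = unpair e in
  branch t (branch p zero (branch (p ∸ 1) succ (branch (p ∸ 2) left (branch (p ∸ 3) right oracle))))
  (branch (t ∸ 1) (pair (decode k (proj₁ (unpair p))) (decode k (proj₂ (unpair p))))
  (branch (t ∸ 2) (comp (decode k (proj₁ (unpair p))) (decode k (proj₂ (unpair p))))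
  (branch (t ∸ 3) (prec (decode k (proj₁ (unpair p))) (decode k (proj₂ (unpair p))))
                  (mu (decode k p)))))

depth : Code → ℕ
depth zero       = 0
depth succ       = 0
depth left       = 0
depth right      = 0
depth oracle     = 0
depth (pair c d) = suc (depth c ⊔ depth d)
depth (comp c d) = suc (depth c ⊔ depth d)
depth (prec c d) = suc (depth c ⊔ depth d)
depth (mu c)     = suc (depth c)

decode-# : ∀ c {k} → depth c < k → decode k (# c) ≡ c
decode-# zero   (s≤s _) rewrite unpair-⟨⟩ 0 0 = refl
decode-# succ   (s≤s _) rewrite unpair-⟨⟩ 0 1 = refl
decode-# left   (s≤s _) rewrite unpair-⟨⟩ 0 2 = refl
decode-# right  (s≤s _) rewrite unpair-⟨⟩ 0 3 = refl
decode-# oracle (s≤s _) rewrite unpair-⟨⟩ 0 4 = refl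
decode-# (pair c d) (s≤s lt) rewrite unpair-⟨⟩ 1 ⟨ # c , # d ⟩ | unpair-⟨⟩ (# c) (# d)
  | decode-# c (≤-trans (s≤s (m≤m⊔n (depth c) (depth d))) lt)
  | decode-# d (≤-trans (s≤s (m≤n⊔m (depth c) (depth d))) lt) = refl
decode-# (comp c d) (s≤s lt) rewrite unpair-⟨⟩ 2 ⟨ # c , # d ⟩ | unpair-⟨⟩ (# c) (# d)
  | decode-# c (≤-trans (s≤s (m≤m⊔n (depth c) (depth d))) lt)
  | decode-# d (≤-trans (s≤s (m≤n⊔m (depth c) (depth d))) lt) = refl
decode-# (prec c d) (s≤s lt) rewrite unpair-⟨⟩ 3 ⟨ # c , # d ⟩ | unpair-⟨⟩ (# c) (# d)
  | decode-# c (≤-trans (s≤s (m≤m⊔n (depth c) (depth d))) lt)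
  | decode-# d (≤-trans (s≤s (m≤n⊔m (depth c) (depth d))) lt) = refl
decode-# (mu c) (s≤s lt) rewrite unpair-⟨⟩ 4 (# c) | decode-# c lt = refl

#-injective : ∀ {c d} → # c ≡ # d → c ≡ d
#-injective {c} {d} eq =
  trans (sym (decode-# c (s≤s (m≤m⊔n (depth c) (depth d)))))
  (trans (cong (decode (suc (depth c ⊔ depth d))) eq)
         (decode-# d (s≤s (m≤n⊔m (depth c) (depth d)))))

-- Programs for step-bounded evaluation

evalᶜ : ∀ {t c u j} → Comp A nat t → Comp A code c → Comp A (list nat) u → Comp A nat j →
        Comp A (may nat) (λ g a → eval g (t g a) (c g a) (u g a) (j g a))
evalᶜ ct cc cu cj = outcomeᶜ (runᶜ
  (ifᶜ (snd ∘ᶜ halveᶜ snd) (justᶜ (oracleᶜ ∘ᶜ fst ∘ᶜ halveᶜ snd)) (nthᶜ (wk cu) (fst ∘ᶜ halveᶜ snd)))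
  ct (evᶜ cc cj nilᶜ))

outputᶜ : ∀ {t c u} → Comp A nat t → Comp A code c → Comp A (list nat) u →
          Comp A (list nat) (λ g a → output g (t g a) (c g a) (u g a))
outputᶜ ct cc cu = natrecᶜ ct nilᶜ
  (maybeᶜ (snd ∘ᶜ snd ∘ᶜ fst ++ᶜ consᶜ snd nilᶜ) (snd ∘ᶜ snd)
    (evalᶜ (wk ct) (wk cc) (wk cu) (lengthᶜ (snd ∘ᶜ snd))))

-- Extracting a path from nested computations

-- Unbounded search runs through all numbers. Where the encoding is a bijection, each of them is a
-- candidate, and decoding does not change the number.
record Numbering (A : Ty) : Set where
  field
    dec     : ℕ → ⟦ A ⟧
    enc-dec : ∀ n → enc A (dec n) ≡ n
    dec-enc : ∀ a → dec (enc A a) ≡ a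

open Numbering

decᶜ : ∀ {f} (N : Numbering X) → Comp A nat f → Comp A X (λ g a → dec N (f g a))
decᶜ {X} N cf = relabel {nat} {X} {λ _ → dec N} (λ _ n → sym (enc-dec N n)) ∘ᶜ cf

numbering : (∀ n → ∃[ a ] enc A a ≡ n) → (∀ {a b} → enc A a ≡ enc A b → a ≡ b) → Numbering A
numbering surj inj = record
  { dec = proj₁ ∘ surj ; enc-dec = proj₂ ∘ surj ; dec-enc = λ a → inj (proj₂ (surj _)) }

nat-numbering : Numbering nat
nat-numbering = record { dec = id ; enc-dec = λ _ → refl ; dec-enc = λ _ → refl }

⊠-numbering : Numbering A → Numbering B → Numbering (A ⊠ B)
⊠-numbering {A} {B} M N = record
  { dec     = λ n → dec M (proj₁ (unpair n)) , dec N (proj₂ (unpair n))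
  ; enc-dec = λ n → trans (cong₂ ⟨_,_⟩ (enc-dec M _) (enc-dec N _)) (⟨⟩-unpair n)
  ; dec-enc = λ (a , b) → trans
      (cong (λ p → dec M (proj₁ p) , dec N (proj₂ p)) (unpair-⟨⟩ (enc A a) (enc B b)))
      (cong₂ _,_ (dec-enc M a) (dec-enc N b))
  }

list-numbering : Numbering A → Numbering (list A)
list-numbering {A} N = numbering (λ n → surj n n ≤-refl) inj
  where
  surj : ∀ b n → n ≤ b → ∃[ l ] encList (enc A) l ≡ n
  surj b       zero    _         = [] , refl
  surj (suc b) (suc n) (s≤s n≤b)
    with surj b (proj₂ (unpair n)) (≤-trans (≤-trans (n≤⟨m,n⟩ (proj₁ (unpair n)) _) (≤-reflexive (⟨⟩-unpair n))) n≤b)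
  ... | l , eq = dec N (proj₁ (unpair n)) ∷ l ,
    cong suc (trans (cong₂ ⟨_,_⟩ (enc-dec N _) eq) (⟨⟩-unpair n))
  inj : ∀ {l l′} → encList (enc A) l ≡ encList (enc A) l′ → l ≡ l′
  inj {[]}    {[]}     _  = refl
  inj {x ∷ l} {y ∷ l′} eq with ⟨⟩-injective {enc A x} {_} {enc A y} (suc-injective eq)
  ... | eq′ = cong₂ _∷_
    (trans (sym (dec-enc N x)) (trans (cong (dec N ∘ proj₁) eq′) (dec-enc N y)))
    (inj (cong proj₂ eq′))

string-numbering : Numbering (list nat)
string-numbering = list-numbering nat-numbering

cat : Str → Baire → Baire
cat []      f n       = f n
cat (x ∷ σ) f zero    = x
cat (x ∷ σ) f (suc n) = cat σ f n

cat-◁ : ∀ v {σ f} → σ ◁ f → v ++ σ ◁ cat v f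
cat-◁ []      σ◁f i       y eq   = σ◁f i y eq
cat-◁ (x ∷ v) σ◁f zero    y refl = refl
cat-◁ (x ∷ v) σ◁f (suc i) y eq   = cat-◁ v σ◁f i y (trans (sym (nth-suc x _ i)) eq)

cat-covers : ∀ v {σ f m} → Covers f m σ → Covers (cat v f) m (v ++ σ)
cat-covers []      cov i       i<m = cov i i<m
cat-covers (x ∷ v) cov zero    i<m = refl
cat-covers (x ∷ v) cov (suc i) i<m =
  trans (nth-suc x _ i) (cat-covers v cov i (<-trans (n<1+n i) i<m))

Path : Pred Str 0ℓ → Set
Path T = ∃ (Paths T)

-- A step-bounded operator on strings that converges to an operator on paths.
record Realises {T : Pred Str 0ℓ} (E : ℕ → Str → Str) (Θ : Path T → Path T) : Set where
  field
    sound    : ∀ t {σ} f → σ ◁ proj₁ f → E t σ ◁ proj₁ (Θ f)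
    complete : ∀ f n → ∃[ m ] ∃[ b ] (∀ t → b ≤ t → ∀ σ →
                 Covers (proj₁ f) m σ → Covers (proj₁ (Θ f)) n (E t σ))

open Realises

id-realises : ∀ {T} → Realises {T} (λ _ σ → σ) id
id-realises = record { sound = λ _ _ p → p ; complete = λ _ n → n , 0 , λ _ _ _ cov → cov }

∘-realises : ∀ {T E F Θ Ξ} → Realises {T} F Ξ → Realises {T} E Θ →
             Realises {T} (λ t → F t ∘ E t) (Ξ ∘ Θ)
sound (∘-realises {Θ = Θ} r s) t {σ} f p = sound r t (Θ f) (sound s t f p)
complete (∘-realises {Θ = Θ} r s) f n with complete r (Θ f) n
... | m , b , p with complete s f m
...   | m′ , b′ , p′ = m′ , b ⊔ b′ , λ t b≤t σ cov →
  p t (m⊔n≤o⇒m≤o b b′ b≤t) _ (p′ t (m⊔n≤o⇒n≤o b b′ b≤t) σ cov)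

leastZero : (p : ℕ → ℕ) → ∃[ z ] p z ≡ 0 → ∃[ z ] (p z ≡ 0 × (∀ m → m < z → ∃[ k ] p m ≡ suc k))
leastZero p (z , eq) = go p z eq
  where
  go : ∀ p z → p z ≡ 0 → ∃[ z ] (p z ≡ 0 × (∀ m → m < z → ∃[ k ] p m ≡ suc k))
  go p zero    eq = 0 , eq , λ _ ()
  go p (suc z) eq with p 0 in eq₀
  ... | zero  = 0 , eq₀ , λ _ ()
  ... | suc k with go (p ∘ suc) z eq
  ...   | z′ , eq′ , min = suc z′ , eq′ , λ { zero _ → k , eq₀ ; (suc m) (s≤s m<z′) → min m m<z′ }

-- Going back from stage `n` to stage `suc k` changes the argument only, and at stage `suc k` the
-- value at `k` is `h k` for every argument.
agreement : ∀ {X : Set} (h : Baire) (F : ℕ → X → Baire) →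
  (∀ n f → h n ≡ F (suc n) f n) → (∀ n f → ∃[ f′ ] F (suc n) f ≡ F n f′) →
  ∀ n f k → k < n → h k ≡ F n f k
agreement h F last back (suc n) f k k<1+n with m≤n⇒m<n∨m≡n (≤-pred k<1+n)
... | inj₂ refl = last n f
... | inj₁ k<n  = trans (agreement h F last back n _ k k<n) (sym (cong (λ f → f k) (proj₂ (back n f))))

mu-search : ∀ {p g a} (cp : Comp (A ⊠ nat) nat p) →
  (r : ∃[ z ] (p g (a , z) ≡ 0 × (∀ m → m < z → ∃[ k ] p g (a , m) ≡ suc k))) →
  g ⊢ mu (prog cp) · enc A a ⇓ proj₁ r
mu-search {g = g} {a} (c by q) (z , eq , min) = mu
  (subst (g ⊢ c · _ ⇓_) eq (q g (a , z)))
  λ m m<z → proj₁ (min m m<z) , subst (g ⊢ c · _ ⇓_) (proj₂ (min m m<z)) (q g (a , m))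

dataT stackT stageT : Ty
dataT  = list nat ⊠ nat ⊠ code
stackT = list (list nat)
stageT = dataT ⊠ nat ⊠ stackT

-- Φ_c(w ρ₀ x Φ_c(⋯ Φ_c(w ρₖ x σ))), where s = ρₖ ∷ ⋯ ∷ ρ₀ ∷ [], as far
-- as t steps of each computation determine it; every Φ_c has the further
-- argument γ.
nested : Baire → ⟦ dataT ⟧ → ℕ → List Str → Str → Str
nested γ (w , x , c) t s σ = foldl (λ τ ρ → output γ t c (w ++ ρ ++ x ∷ τ)) σ s

abstract
  trialNumbering : Numbering (list nat ⊠ nat)
  trialNumbering = ⊠-numbering string-numbering nat-numbering

candidate : ℕ → Str
candidate z = proj₁ (dec trialNumbering z)

fuel : ℕ → ℕ
fuel z = proj₂ (dec trialNumbering z)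

trial : Baire → ⟦ stageT ⟧ × ℕ → Maybe ℕ
trial γ ((D , k , s) , z) = nth (nested γ D (fuel z) (candidate z ∷ s) []) k

module Extraction (leaf? : Str → Bool) (leaf?ᶜ : Comp (list nat) bool (λ _ → leaf?)) where

  -- Success is 0 because `mu` looks for zeros. Only leaves may pass, since every string on the
  -- stack must induce a map of paths.
  test : Baire → ⟦ stageT ⟧ × ℕ → ℕ
  test γ p = if leaf? (candidate (proj₂ p)) then maybe (λ _ → 0) 1 (trial γ p) else 1

  private
    candidateᶜ : Comp (stageT ⊠ nat) (list nat) (λ _ p → candidate (proj₂ p))
    candidateᶜ = fst ∘ᶜ decᶜ trialNumbering snd

    trialᶜ : Comp (stageT ⊠ nat) (may nat) trial
    trialᶜ = nthᶜ
      (foldlᶜ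
        (outputᶜ (snd ∘ᶜ decᶜ trialNumbering (snd ∘ᶜ fst)) (snd ∘ᶜ snd ∘ᶜ fst ∘ᶜ fst ∘ᶜ fst)
          (fst ∘ᶜ fst ∘ᶜ fst ∘ᶜ fst ++ᶜ snd ∘ᶜ snd ++ᶜ
            consᶜ (fst ∘ᶜ snd ∘ᶜ fst ∘ᶜ fst ∘ᶜ fst) (fst ∘ᶜ snd)))
        nilᶜ (consᶜ candidateᶜ (snd ∘ᶜ snd ∘ᶜ fst)))
      (fst ∘ᶜ snd ∘ᶜ fst)

    testᶜ : Comp (stageT ⊠ nat) nat test
    testᶜ = ifᶜ (leaf?ᶜ ∘ᶜ candidateᶜ) (maybeᶜ (constᶜ 0) (constᶜ 1) trialᶜ) (constᶜ 1)

    pushᶜ : Comp (stageT ⊠ nat) stackT (λ _ p → candidate (proj₂ p) ∷ proj₂ (proj₂ (proj₁ p)))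
    pushᶜ = consᶜ candidateᶜ (snd ∘ᶜ snd ∘ᶜ fst)

    valueᶜ : Comp (stageT ⊠ nat) nat (λ γ p → fromMaybe 0 (trial γ p))
    valueᶜ = fromMaybeᶜ (constᶜ 0) trialᶜ

    -- The search is partial and hence no `Comp`. On `⟨ d , n ⟩`, `prec` hands its step
    -- `⟨ d , ⟨ n , s ⟩ ⟩`, which is the encoding of the stage with `n` leaves chosen; this dictates
    -- the order in `stageT`.
    search stacks : Code
    search = mu (prog testᶜ)
    stacks = prec (prog (nilᶜ {A = dataT} {X = list nat})) (comp (prog pushᶜ) (pair I search))

  abstract
    extract : Code
    extract = comp (comp (prog valueᶜ) (pair I search)) (pair left (pair right stacks))

  -- The path `f₀` only witnesses that the searches succeed: `extract` is defined before it is
  -- given.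
  module _ {T : Pred Str 0ℓ} (γ : Baire) (w : Str) (x : ℕ) (c : Code)
    (run₀ : (f : Path T) → ∃[ h ] ∀ n → cat w (proj₁ f) ⊕ γ ⊢ c · n ⇓ proj₁ {B = Paths T} h n)
    (run₁ : ∀ ρ → leaf? ρ ≡ true → (f : Path T) →
            ∃[ h ] ∀ n → cat w (cat ρ (cat (x ∷ []) (proj₁ f))) ⊕ γ ⊢ c · n ⇓ proj₁ {B = Paths T} h n)
    (f₀ : Path T)
    (dense : ∀ m → ∃[ ρ ] (leaf? ρ ≡ true × Covers (proj₁ f₀) m ρ))
    where

    private
      d : ⟦ dataT ⟧
      d = w , x , c

      AllLeaf : List Str → Set
      AllLeaf = All (λ ρ → leaf? ρ ≡ true)

      Θ : ∀ s → AllLeaf s → Path T → Path T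
      Θ []      []        f = f
      Θ (ρ ∷ s) (lρ ∷ ls) f = Θ s ls (proj₁ (run₁ ρ lρ f))

      output-realises : ∀ ρ lρ → Realises {T} (λ t σ → output γ t c (w ++ ρ ++ x ∷ σ)) (proj₁ ∘ run₁ ρ lρ)
      sound (output-realises ρ lρ) t f p =
        output-sound (proj₂ (run₁ ρ lρ f)) t (cat-◁ w (cat-◁ ρ (cat-◁ (x ∷ []) p)))
      complete (output-realises ρ lρ) f n with output-complete (proj₂ (run₁ ρ lρ f)) n
      ... | m , b , p = m , b , λ t b≤t σ cov →
        p t b≤t _ (cat-covers w (cat-covers ρ (cat-covers (x ∷ []) cov)))

      nested-realises : ∀ s ls → Realises {T} (λ t → nested γ d t s) (Θ s ls)
      nested-realises []      []        = id-realises
      nested-realises (ρ ∷ s) (lρ ∷ ls) = ∘-realises (nested-realises s ls) (output-realises ρ lρ)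

      test-passes : ∀ p {v} → leaf? (candidate (proj₂ p)) ≡ true → trial γ p ≡ just v → test γ p ≡ 0
      test-passes p lρ eq =
        trans (cong (if_then maybe (λ _ → 0) 1 (trial γ p) else 1) lρ) (cong (maybe (λ _ → 0) 1) eq)

      -- The maps already stacked need `m` values of the path `h` computed from w ⌢ `f₀` to
      -- determine their value at `k`, and these need `m′` values of `f₀`. A leaf that agrees with
      -- `f₀` up to `m′` provides them, whatever follows it.
      supply : ∀ k s → AllLeaf s → ∃[ z ] test γ ((d , k , s) , z) ≡ 0
      supply k s ls with run₀ f₀
      ... | h , h⇓ with complete (nested-realises s ls) h (suc k)
      ...   | m , b , p with output-complete h⇓ m
      ...     | m′ , b′ , p′ with dense m′
      ...       | ρ , lρ , cov = enc (list nat ⊠ nat) (ρ , b ⊔ b′) , eq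
        where
        value : nth (nested γ d (b ⊔ b′) (ρ ∷ s) []) k ≡ just (proj₁ (Θ s ls h) k)
        value = p (b ⊔ b′) (m≤m⊔n b b′) _
          (p′ (b ⊔ b′) (m≤n⊔m b b′) _ (cat-covers w λ i i<m → nth-++ˡ ρ _ {i} (cov i i<m)))
          k (n<1+n k)
        eq : test γ ((d , k , s) , enc (list nat ⊠ nat) (ρ , b ⊔ b′)) ≡ 0
        eq = test-passes ((d , k , s) , enc (list nat ⊠ nat) (ρ , b ⊔ b′)) (trans (cong (leaf? ∘ proj₁) (dec-enc trialNumbering (ρ , b ⊔ b′))) lρ)
          (trans (cong (λ q → nth (nested γ d (proj₂ q) (proj₁ q ∷ s) []) k)
                       (dec-enc trialNumbering (ρ , b ⊔ b′))) value)

      found : ∀ k s → AllLeaf s → ∃[ z ] _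
      found k s ls = leastZero (λ z → test γ ((d , k , s) , z)) (supply k s ls)

      test-zero : ∀ p → test γ p ≡ 0 → leaf? (candidate (proj₂ p)) ≡ true × ∃[ v ] trial γ p ≡ just v
      test-zero p eq with leaf? (candidate (proj₂ p)) | trial γ p
      ... | true | just v = refl , v , refl

      stack : ∀ k → Σ (List Str) AllLeaf
      stage : ∀ k → ∃[ z ] (test γ ((d , k , proj₁ (stack k)) , z) ≡ 0 ×
                (∀ m → m < z → ∃[ j ] test γ ((d , k , proj₁ (stack k)) , m) ≡ suc j))
      stack zero    = [] , []
      stack (suc k) =
        candidate (proj₁ (stage k)) ∷ proj₁ (stack k) ,
        proj₁ (test-zero ((d , k , proj₁ (stack k)) , proj₁ (stage k)) (proj₁ (proj₂ (stage k)))) ∷ proj₂ (stack k)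
      stage k = found k (proj₁ (stack k)) (proj₂ (stack k))

      search⇓ : ∀ k → γ ⊢ search · enc stageT (d , k , proj₁ (stack k)) ⇓ proj₁ (stage k)
      search⇓ k = mu-search {a = d , k , proj₁ (stack k)} testᶜ (stage k)

      stacks⇓ : ∀ k → γ ⊢ stacks · ⟨ enc dataT d , k ⟩ ⇓ enc stackT (proj₁ (stack k))
      stacks⇓ zero    = prec-zero {a = enc dataT d} (correct nilᶜ γ d)
      stacks⇓ (suc k) = prec-suc {a = enc dataT d} (stacks⇓ k)
        (comp (pair (I-correct _) (search⇓ k)) (correct pushᶜ γ ((d , k , proj₁ (stack k)) , _)))

      h : Baire
      h k = fromMaybe 0 (trial γ ((d , k , proj₁ (stack k)) , proj₁ (stage k)))

      h-stage : ∀ k → trial γ ((d , k , proj₁ (stack k)) , proj₁ (stage k)) ≡ just (h k)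
      h-stage k = trans eq (cong (just ∘ fromMaybe 0) (sym eq))
        where
        eq : trial γ ((d , k , proj₁ (stack k)) , proj₁ (stage k)) ≡ just _
        eq = proj₂ (proj₂ (test-zero ((d , k , proj₁ (stack k)) , proj₁ (stage k)) (proj₁ (proj₂ (stage k)))))

      -- The value was found from the empty string, an initial segment of every `f`.
      h-last : ∀ n f → h n ≡ proj₁ (Θ (proj₁ (stack (suc n))) (proj₂ (stack (suc n))) f) n
      h-last n f = sound (nested-realises (proj₁ (stack (suc n))) (proj₂ (stack (suc n))))
                     (fuel (proj₁ (stage n))) f []-◁ n (h n) (h-stage n)

      h-agrees : ∀ n f k → k < n → h k ≡ proj₁ (Θ (proj₁ (stack n)) (proj₂ (stack n)) f) k
      h-agrees = agreement h (λ n f → proj₁ (Θ (proj₁ (stack n)) (proj₂ (stack n)) f)) h-last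
        -- A newly stacked leaf acts first, so the earlier maps are applied to the image of `f`
        -- under it.
        λ n f → proj₁ (run₁ _ _ f) , refl

    abstract
      extract-correct : ∃[ h ] (Paths T h × (∀ n → γ ⊢ extract · ⟨ enc dataT d , n ⟩ ⇓ h n))
      extract-correct = h , in-T , λ k →
        comp (pair (left {a = enc dataT d} {k}) (pair (right {a = enc dataT d} {k}) (stacks⇓ k)))
             (comp (pair (I-correct _) (search⇓ k))
                   (correct valueᶜ γ ((d , k , proj₁ (stack k)) , _)))
        where
        in-T : Paths T h
        in-T n = subst T (sym (↾-cong n (h-agrees n f₀)))
          (proj₂ (Θ (proj₁ (stack n)) (proj₂ (stack n)) f₀) n)

-- Leaves

-- Computability is defined by the zero oracle; answering all queries by 0 internally makes the
-- program work over every oracle.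
withoutOracle : Code → Code
withoutOracle zero       = zero
withoutOracle succ       = succ
withoutOracle left       = left
withoutOracle right      = right
withoutOracle oracle     = zero
withoutOracle (pair c d) = pair (withoutOracle c) (withoutOracle d)
withoutOracle (comp c d) = comp (withoutOracle c) (withoutOracle d)
withoutOracle (prec c d) = prec (withoutOracle c) (withoutOracle d)
withoutOracle (mu c)     = mu (withoutOracle c)

withoutOracle-correct : ∀ {c x y g} → (λ _ → 0) ⊢ c · x ⇓ y → g ⊢ withoutOracle c · x ⇓ y
withoutOracle-correct zero            = zero
withoutOracle-correct succ            = succ
withoutOracle-correct (left {a})      = left {a = a}
withoutOracle-correct (right {a})     = right {a = a}
withoutOracle-correct oracle          = zero
withoutOracle-correct (pair p q)      = pair (withoutOracle-correct p) (withoutOracle-correct q)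
withoutOracle-correct (comp p q)      = comp (withoutOracle-correct p) (withoutOracle-correct q)
withoutOracle-correct (prec-zero p)   = prec-zero (withoutOracle-correct p)
withoutOracle-correct (prec-suc {a = a} p q) =
  prec-suc {a = a} (withoutOracle-correct p) (withoutOracle-correct q)
withoutOracle-correct (mu p q)        =
  mu (withoutOracle-correct p) λ m m<n → proj₁ (q m m<n) , withoutOracle-correct (proj₂ (q m m<n))

fromComputable : ∀ {ψ} → ComputableOnStr ψ → Comp (list nat) nat (λ _ → ψ)
fromComputable {ψ} (c , p) = withoutOracle c by λ g σ → withoutOracle-correct
  (subst (λ k → (λ _ → 0) ⊢ c · k ⇓ ψ σ) (⌜⌝≡enc σ) (p σ))

toComputable : ∀ {ψ} → Comp (list nat) nat (λ _ → ψ) → ComputableOnStr ψ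
toComputable {ψ} (c by p) = c , λ σ →
  subst (λ k → (λ _ → 0) ⊢ c · k ⇓ ψ σ) (sym (⌜⌝≡enc σ)) (p _ σ)

record Decider (S : Pred Str 0ℓ) : Set where
  field
    mem?         : Str → Bool
    mem?ᶜ        : Comp (list nat) bool (λ _ → mem?)
    mem-sound    : ∀ {σ} → mem? σ ≡ true → σ ∈ S
    mem-complete : ∀ {σ} → σ ∈ S → mem? σ ≡ true

decider : ∀ {S} → ComputableSet S → Decider S
decider (χ , c , p) = record
  { mem?         = λ σ → eqb (χ σ) 1
  ; mem?ᶜ        = eqbᶜ (fromComputable c) (constᶜ 1)
  ; mem-sound    = λ {σ} eq → Equivalence.from (p σ) (eqb-true {χ σ} eq)
  ; mem-complete = λ {σ} σ∈S → cong (λ k → eqb k 1) (Equivalence.to (p σ) σ∈S)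
  }

not-false : ∀ {b} → b ≢ true → b ≡ false
not-false {true}  h = contradiction refl h
not-false {false} h = refl

true-not : ∀ {b} → b ≢ true → not b ≡ true
true-not h = cong not (not-false h)

∧-intro : ∀ {a b} → a ≡ true → b ≡ true → a ∧ b ≡ true
∧-intro refl refl = refl

-- Initial segments and limits of growing strings

nth-length : ∀ (σ : Str) {i} → i < length σ → nth σ i ≡ just (at σ i)
nth-length (x ∷ σ) {zero}  _         = refl
nth-length (x ∷ σ) {suc i} (s≤s i<) = begin
  nth (x ∷ σ) (suc i)       ≡⟨ nth-suc x σ i ⟩
  nth σ i                   ≡⟨ nth-length σ i< ⟩
  just (at σ i)             ≡⟨ cong (just ∘ fromMaybe 0) (nth-suc x σ i) ⟨
  just (at (x ∷ σ) (suc i)) ∎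
  where open ≡-Reasoning

at-length : ∀ {σ f i} → σ ◁ f → i < length σ → at σ i ≡ f i
at-length {σ} σ◁f i< = σ◁f _ _ (nth-length σ i<)

at-↾ : ∀ g n {i} → i < n → at (g ↾ n) i ≡ g i
at-↾ g n i<n = cong (fromMaybe 0) (nth-applyUpTo g n i<n)

◁-++ : ∀ σ {ρ f} → σ ++ ρ ◁ f → σ ◁ f
◁-++ σ {ρ} h i v eq = h i v (nth-++ˡ σ ρ {i} eq)

↾-◁ : ∀ f n → f ↾ n ◁ f
↾-◁ f zero    i       v eq with () ← trans (sym (nth-[] i)) eq
↾-◁ f (suc n) zero    v refl = refl
↾-◁ f (suc n) (suc i) v eq =
  ↾-◁ (f ∘ suc) n i v (trans (sym (nth-suc (f 0) (applyUpTo (f ∘ suc) n) i)) eq)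

covers-prefix : ∀ {f} n σ → Covers f n σ → f ↾ n ⊑ σ
covers-prefix zero    σ       _   = []
covers-prefix (suc n) []      cov with () ← cov 0 (s≤s z≤n)
covers-prefix (suc n) (x ∷ σ) cov =
  sym (just-injective (cov 0 (s≤s z≤n))) ∷
  covers-prefix n σ λ i i<n → trans (sym (nth-suc x σ i)) (cov (suc i) (s≤s i<n))

module Limit (W : ℕ → Str) (grows : ∀ n → ∃[ e ] W (suc n) ≡ W n ++ e) (long : ∀ n → n ≤ length (W n)) where

  limit : Baire
  limit i = at (W (suc i)) i

  stable : ∀ {m n i v} → m ≤ n → nth (W m) i ≡ just v → nth (W n) i ≡ just v
  stable {m} {n} {i} {v} m≤n eq = subst (λ k → nth (W k) i ≡ just v) (m∸n+n≡m m≤n) (go (n ∸ m))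
    where
    go : ∀ k → nth (W (k + m)) i ≡ just v
    go zero    = eq
    go (suc k) = trans (cong (λ τ → nth τ i) (proj₂ (grows (k + m)))) (nth-++ˡ (W (k + m)) _ {i} (go k))

  limit-◁ : ∀ n → W n ◁ limit
  limit-◁ n i v eq = just-injective (trans
    (sym (stable {i = i} (m≤m⊔n n (suc i)) eq))
    (stable {i = i} (m≤n⊔m n (suc i)) (nth-length (W (suc i)) (long (suc i)))))

  limit-covers : ∀ n → Covers limit n (W n)
  limit-covers n i i<n = trans (nth-length (W n) i<) (cong just (at-length {W n} (limit-◁ n) i<))
    where
    i< = ≤-trans i<n (long n)

classicalLeast : ExcludedMiddle 0ℓ → (V : ℕ → Set) → ∃ V → ∃[ n ] (V n × (∀ m → m < n → ¬ V m))
classicalLeast em V (n , v) = go (suc n) n (n<1+n n) v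
  where
  go : ∀ b n → n < b → V n → ∃[ n ] (V n × (∀ m → m < n → ¬ V m))
  go (suc b) n n<b v with em {∃[ m ] (m < n × V m)}
  ... | yes (m , m<n , v′) = go b m (≤-trans m<n (≤-pred n<b)) v′
  ... | no  none           = n , v , λ m m<n v′ → none (m , m<n , v′)

-- Decidability of leaves and their existence above every node

module Leaves {T : Pred Str 0ℓ} (isTree : IsBinaryTree T) (𝐓 : Decider T) where

  open IsBinaryTree isTree
  open Decider 𝐓

  leaf? : Str → Bool
  leaf? ρ = mem? ρ ∧ not (mem? (ρ ∷ʳ 0)) ∧ not (mem? (ρ ∷ʳ 1))

  leaf?ᶜ : Comp (list nat) bool (λ _ → leaf?)
  leaf?ᶜ = mem?ᶜ ∧ᶜ notᶜ (mem?ᶜ ∘ᶜ (idᶜ ++ᶜ consᶜ (constᶜ 0) nilᶜ)) ∧ᶜ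
           notᶜ (mem?ᶜ ∘ᶜ (idᶜ ++ᶜ consᶜ (constᶜ 1) nilᶜ))

  no-child : ∀ ρ → ρ ∷ʳ 0 ∉ T → ρ ∷ʳ 1 ∉ T → ∀ x → ρ ∷ʳ x ∉ T
  no-child ρ no₀ no₁ 0 h = no₀ h
  no-child ρ no₀ no₁ 1 h = no₁ h
  no-child ρ no₀ no₁ (suc (suc x)) h with ++⁻ʳ ρ (binary _ h)
  ... | s≤s (s≤s ()) ∷ []

  leaf?-sound : ∀ {ρ} → leaf? ρ ≡ true → Leaf T ρ
  leaf?-sound {ρ} eq with ∧-true {mem? ρ} eq
  ... | m , eq′ with ∧-true {not (mem? (ρ ∷ʳ 0))} eq′
  ...   | no₀ , no₁ = mem-sound m , no-child ρ (absent no₀) (absent no₁)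
    where
    absent : ∀ {σ} → not (mem? σ) ≡ true → σ ∉ T
    absent eq σ∈T with () ← trans (sym (not-true eq)) (mem-complete σ∈T)

  leaf?-complete : ∀ {ρ} → Leaf T ρ → leaf? ρ ≡ true
  leaf?-complete (ρ∈T , none) = ∧-intro (mem-complete ρ∈T)
    (∧-intro (true-not (none 0 ∘ mem-sound)) (true-not (none 1 ∘ mem-sound)))

  -- Above a string without leaves, greedily choosing children is a
  -- computable path.
  leaf-above : ExcludedMiddle 0ℓ → (∀ f → f ∈ Paths T → ¬ Computable f) →
               ∀ σ → σ ∈ T → ∃[ e ] Leaf T (σ ++ e)
  leaf-above em special σ σ∈T with em {∃[ e ] Leaf T (σ ++ e)}
  ... | yes p    = p
  ... | no  none = contradiction computable (special limit path)
    where
    extra : Str → Str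
    -- One test suffices: if 0 is not a child, then 1 is, as there is no leaf above `σ`.
    extra τ = (if mem? (τ ∷ʳ 0) then 0 else 1) ∷ []

    W : ℕ → Str
    W = natrec σ (λ _ τ → τ ++ extra τ)

    grows : ∀ n → ∃[ e ] W (suc n) ≡ W n ++ e
    grows n = _ , refl

    long : ∀ n → n ≤ length (W n)
    long zero    = z≤n
    long (suc n) rewrite length-++ (W n) {extra (W n)}
      | +-comm (length (W n)) 1 = s≤s (long n)

    open Limit W grows long

    above : ∀ n → ∃[ e ] W n ≡ σ ++ e
    above zero    = [] , sym (++-identityʳ σ)
    above (suc n) with above n
    ... | e , eq = e ++ extra (W n) , trans (cong (_++ extra (W n)) eq) (++-assoc σ e _)

    child : ∀ τ → (∃[ e ] τ ≡ σ ++ e) → τ ∈ T → τ ++ extra τ ∈ T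
    child τ (e , refl) τ∈T with mem? (τ ∷ʳ 0) in eq₀ | mem? (τ ∷ʳ 1) in eq₁
    ... | true  | _     = mem-sound eq₀
    ... | false | true  = mem-sound eq₁
    ... | false | false = contradiction
      (e , τ∈T , no-child τ (λ h → absurd (trans (sym eq₀) (mem-complete h)))
                            (λ h → absurd (trans (sym eq₁) (mem-complete h)))) none
      where
      absurd : false ≢ true
      absurd ()

    W∈T : ∀ n → W n ∈ T
    W∈T zero    = σ∈T
    W∈T (suc n) = child (W n) (above n) (W∈T n)

    path : limit ∈ Paths T
    path n = closed _ (W n) (covers-prefix n (W n) (limit-covers n)) (W∈T n)

    limitᶜ : Comp nat nat (λ _ → limit)
    limitᶜ = atᶜ (natrecᶜ (sucᶜ idᶜ) (constᶜ σ)
        (snd ∘ᶜ snd ++ᶜ consᶜ (ifᶜ (mem?ᶜ ∘ᶜ (snd ∘ᶜ snd ++ᶜ consᶜ (constᶜ 0) nilᶜ)) (constᶜ 0) (constᶜ 1)) nilᶜ))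
      idᶜ

    computable : Computable limit
    computable = prog limitᶜ , correct limitᶜ _

-- The new learner

length-≤ˡ : ∀ (w v : Str) → length w ≤ length (w ++ v)
length-≤ˡ w v = ≤-trans (m≤m+n _ _) (≤-reflexive (sym (length-++ w)))

candidateT : Ty
candidateT = list (list nat ⊠ nat) ⊠ nat

abstract
  candidateNumbering : Numbering candidateT
  candidateNumbering = ⊠-numbering (list-numbering (⊠-numbering string-numbering nat-numbering)) nat-numbering

  testNumbering : Numbering (list nat ⊠ list nat)
  testNumbering = ⊠-numbering string-numbering string-numbering

if-true : ∀ {b c} → (if b then c else true) ≡ true → b ≡ true → c ≡ true
if-true eq refl = eq

if-intro : ∀ {b c} → (b ≡ true → c ≡ true) → (if b then c else true) ≡ true
if-intro {true}  h = h refl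
if-intro {false} h = refl

-- The s-m-n construction: the parameter is hard-wired, and the number of the result is computable
-- from it, as the learner must output that number.
program : ℕ → Code → Code
program m c = comp c (pair (K m) I)

program-correct : ∀ {g c m n y} → g ⊢ c · ⟨ m , n ⟩ ⇓ y → g ⊢ program m c · n ⇓ y
program-correct {m = m} p = comp (pair (K-correct m) (I-correct _)) p

#Kᶜ : Comp nat nat (λ _ n → # (K n))
#Kᶜ = extᶜ (natrecᶜ idᶜ (constᶜ 0) (pairNatᶜ (constᶜ 2) (pairNatᶜ (constᶜ (# succ)) (snd ∘ᶜ snd))))
  λ _ → lem
  where
  lem : ∀ n → natrec 0 (λ _ e → ⟨ 2 , ⟨ # succ , e ⟩ ⟩) n ≡ # (K n)
  lem zero    = refl
  lem (suc n) = cong (λ e → ⟨ 2 , ⟨ # succ , e ⟩ ⟩) (lem n)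

#programᶜ : ∀ {m} c → Comp A nat m → Comp A nat (λ g a → # (program (m g a) c))
#programᶜ c cm = pairNatᶜ (constᶜ 2) (pairNatᶜ (constᶜ (# c))
  (pairNatᶜ (constᶜ 1) (pairNatᶜ (#Kᶜ ∘ᶜ cm) (constᶜ (# I)))))

module Learning (guess : Str → ℕ) (guessᶜ : Comp (list nat) nat (λ _ → guess))
  (inP? inQ? leaf? : Str → Bool)
  (inP?ᶜ : Comp (list nat) bool (λ _ → inP?)) (inQ?ᶜ : Comp (list nat) bool (λ _ → inQ?))
  (leaf?ᶜ : Comp (list nat) bool (λ _ → leaf?)) (extractor : Code)
  where

  -- The guess of the given learner on the part of v ⊕ γ that v determines.
  -- Only initial segments of even length arise in this way, which is
  -- enough, since the guesses converge.
  verdict : Baire → Str → ℕ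
  verdict γ v = guess ((at v ⊕ γ) ↾ (length v + length v))

  verdict-limit : ∀ {γ v f} → v ◁ f → verdict γ v ≡ guess ((f ⊕ γ) ↾ (length v + length v))
  verdict-limit {v = v} v◁f =
    cong guess (⊕-↾-cong (length v) (λ i i< → at-length {v} v◁f i<) (λ _ _ → refl))

  verdict-local : ∀ {γ n} v → length v ≤ n → verdict (at (γ ↾ n)) v ≡ verdict γ v
  verdict-local {γ} {n} v v≤n =
    cong guess (⊕-↾-cong (length v) (λ _ _ → refl) λ i i< → at-↾ γ n (≤-trans i< v≤n))

  -- Strings longer than `n` pass. Thus, for `v` at least as long as `w`, only `γ ↾ n` is consulted,
  -- and as `n` grows the answer can change only from `true` to `false`.
  agrees? : ℕ → Baire → Str → Str → Bool
  agrees? n γ w v = if leb (length v) n then eqb (verdict γ v) (verdict γ w) else true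

  -- One pair serves both kinds of extension: `ρ` is tried as a tail of `w`, and, if it is a leaf,
  -- also as a block followed by `σ`.
  consistent? : ℕ → Baire → Str → ℕ → Str × Str → Bool
  consistent? n γ w x (ρ , σ) =
    (if inP? ρ then agrees? n γ w (w ++ ρ) else true) ∧
    (if leaf? ρ ∧ inP? σ then agrees? n γ w (w ++ ρ ++ x ∷ σ) else true)

  Locked : Baire → Str → ℕ → Set
  Locked γ w x = ∀ n p → consistent? n γ w x p ≡ true

  addBlock : Str × Str × Bool → Str × ℕ → Str × Str × Bool
  addBlock r p = proj₂ p ∷ proj₁ r , proj₁ p ++ proj₂ p ∷ proj₁ (proj₂ r) , leaf? (proj₁ p) ∧ proj₂ (proj₂ r)

  -- The blocks are listed from the last one to the first one.
  assemble : List (Str × ℕ) → Str × Str × Bool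
  assemble = foldl addBlock ([] , [] , true)

  blocks : ℕ → Str × Str × Bool
  blocks d = assemble (proj₁ (dec candidateNumbering d))

  word : ℕ → Str
  word d = proj₁ (proj₂ (blocks d))

  bit : ℕ → ℕ
  bit d = proj₂ (dec candidateNumbering d)

  -- Only τ ⌢ x ∈ T_Q is asked for, which is decidable and already puts w ⌢ ρ ⌢ x ⌢ f into Q ▼ P for
  -- every leaf ρ and every f ∈ P.
  valid? : ℕ → Bool
  valid? d = proj₂ (proj₂ (blocks d)) ∧ inQ? (proj₁ (blocks d) ++ bit d ∷ [])

  unrefuted? : Str → ℕ → Bool
  unrefuted? σ d =
    valid? d ∧ allBelow (length σ) (λ z → consistent? (length σ) (at σ) (word d) (bit d) (dec testNumbering z))

  -- Bounded minimisation: as long as all candidates fail, the accumulator `d` equals the counter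
  -- `k`, and it stays at the first one that passes. If none passes, the result is the length.
  choice : Str → ℕ
  choice σ = natrec 0 (λ k d → if unrefuted? σ d then d else suc k) (length σ)

  -- The verdict takes the place of the code in `dataT`: a code is encoded by its number, so the
  -- extractor may be run on this triple once the verdict is such a number.
  parameters : Str → ℕ
  parameters σ =
    enc (list nat ⊠ nat ⊠ nat) (word (choice σ) , bit (choice σ) , verdict (at σ) (word (choice σ)))

  newGuess : Str → ℕ
  newGuess σ = # (program (parameters σ) extractor)

  verdictᶜ : ∀ {s v} → Comp A (list nat) s → Comp A (list nat) v →
             Comp A nat (λ g a → verdict (at (s g a)) (v g a))
  verdictᶜ {s = s} {v} cs cv = extᶜ
    (guessᶜ ∘ᶜ applyUpToᶜ
      (ifᶜ (snd ∘ᶜ halveᶜ snd) (atᶜ (wk cs) (fst ∘ᶜ halveᶜ snd)) (atᶜ (wk cv) (fst ∘ᶜ halveᶜ snd)))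
      (lengthᶜ cv +ᶜ lengthᶜ cv))
    λ g a → cong guess (↾-cong (length (v g a) + length (v g a)) λ i _ →
      sym (⊕-halve (at (v g a)) (at (s g a)) i))

  agreesᶜ : ∀ {n s w v} → Comp A nat n → Comp A (list nat) s → Comp A (list nat) w → Comp A (list nat) v →
            Comp A bool (λ g a → agrees? (n g a) (at (s g a)) (w g a) (v g a))
  agreesᶜ cn cs cw cv =
    ifᶜ (lebᶜ (lengthᶜ cv) cn) (eqbᶜ (verdictᶜ cs cv) (verdictᶜ cs cw)) (constᶜ true)

  consistentᶜ : ∀ {n s w x p} → Comp A nat n → Comp A (list nat) s → Comp A (list nat) w →
    Comp A nat x → Comp A (list nat ⊠ list nat) p →
    Comp A bool (λ g a → consistent? (n g a) (at (s g a)) (w g a) (x g a) (p g a))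
  consistentᶜ cn cs cw cx cp =
    ifᶜ (inP?ᶜ ∘ᶜ ρ) (agreesᶜ cn cs cw (cw ++ᶜ ρ)) (constᶜ true) ∧ᶜ
    ifᶜ (leaf?ᶜ ∘ᶜ ρ ∧ᶜ inP?ᶜ ∘ᶜ σ) (agreesᶜ cn cs cw (cw ++ᶜ ρ ++ᶜ consᶜ cx σ)) (constᶜ true)
    where
    ρ = fst ∘ᶜ cp
    σ = snd ∘ᶜ cp

  blocksᶜ : Comp nat (list nat ⊠ list nat ⊠ bool) (λ _ → blocks)
  blocksᶜ = foldlᶜ
    (consᶜ x (fst ∘ᶜ acc) ,ᶜ (ρ ++ᶜ consᶜ x (fst ∘ᶜ snd ∘ᶜ acc)) ,ᶜ (leaf?ᶜ ∘ᶜ ρ ∧ᶜ snd ∘ᶜ snd ∘ᶜ acc))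
    (constᶜ ([] , [] , true)) (fst ∘ᶜ decᶜ candidateNumbering idᶜ)
    where
    Env : Ty
    Env = nat ⊠ (list nat ⊠ list nat ⊠ bool) ⊠ (list nat ⊠ nat)
    acc : Comp Env (list nat ⊠ list nat ⊠ bool) (λ _ p → proj₁ (proj₂ p))
    acc = fst ∘ᶜ snd
    ρ : Comp Env (list nat) (λ _ p → proj₁ (proj₂ (proj₂ p)))
    ρ = fst ∘ᶜ snd ∘ᶜ snd
    x : Comp Env nat (λ _ p → proj₂ (proj₂ (proj₂ p)))
    x = snd ∘ᶜ snd ∘ᶜ snd

  wordᶜ : Comp nat (list nat) (λ _ → word)
  wordᶜ = fst ∘ᶜ snd ∘ᶜ blocksᶜ

  bitᶜ : Comp nat nat (λ _ → bit)
  bitᶜ = snd ∘ᶜ decᶜ candidateNumbering idᶜ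

  validᶜ : Comp nat bool (λ _ → valid?)
  validᶜ = snd ∘ᶜ snd ∘ᶜ blocksᶜ ∧ᶜ inQ?ᶜ ∘ᶜ (fst ∘ᶜ blocksᶜ ++ᶜ consᶜ bitᶜ nilᶜ)

  unrefutedᶜ : Comp (list nat ⊠ nat) bool (λ _ p → unrefuted? (proj₁ p) (proj₂ p))
  unrefutedᶜ = validᶜ ∘ᶜ snd ∧ᶜ allBelowᶜ
    (consistentᶜ (lengthᶜ (fst ∘ᶜ fst)) (fst ∘ᶜ fst) (wordᶜ ∘ᶜ snd ∘ᶜ fst) (bitᶜ ∘ᶜ snd ∘ᶜ fst)
      (decᶜ testNumbering snd))
    (lengthᶜ fst)

  choiceᶜ : Comp (list nat) nat (λ _ → choice)
  choiceᶜ = natrecᶜ (lengthᶜ idᶜ) (constᶜ 0)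
    (ifᶜ (unrefutedᶜ ∘ᶜ (fst ,ᶜ snd ∘ᶜ snd)) (snd ∘ᶜ snd) (sucᶜ (fst ∘ᶜ snd)))

  parametersᶜ : Comp (list nat) nat (λ _ → parameters)
  parametersᶜ = natᶜ {X = list nat ⊠ nat ⊠ nat}
    (wordᶜ ∘ᶜ choiceᶜ ,ᶜ bitᶜ ∘ᶜ choiceᶜ ,ᶜ verdictᶜ idᶜ (wordᶜ ∘ᶜ choiceᶜ))

  newLearner : Learner
  newLearner = record { guess = newGuess ; computable = toComputable (#programᶜ extractor parametersᶜ) }

  agrees-antitone : ∀ {m n} γ w v → m ≤ n → agrees? n γ w v ≡ true → agrees? m γ w v ≡ true
  agrees-antitone γ w v m≤n eq = if-intro λ v≤m →
    if-true eq (leb-≤ (≤-trans (leb-true {length v} v≤m) m≤n))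

  consistent-antitone : ∀ {m n} γ w x p → m ≤ n →
    consistent? n γ w x p ≡ true → consistent? m γ w x p ≡ true
  consistent-antitone γ w x (ρ , σ) m≤n eq with ∧-true eq
  ... | eq₁ , eq₂ = ∧-intro
    (if-intro {inP? ρ} λ p → agrees-antitone γ w (w ++ ρ) m≤n (if-true eq₁ p))
    (if-intro {leaf? ρ ∧ inP? σ} λ p → agrees-antitone γ w (w ++ ρ ++ x ∷ σ) m≤n (if-true eq₂ p))

  agrees-local : ∀ {n γ w} v → length w ≤ length v → agrees? n (at (γ ↾ n)) w v ≡ agrees? n γ w v
  agrees-local {n} {γ} {w} v w≤v with leb (length v) n in eq
  ... | false = refl
  ... | true  = cong₂ eqb (verdict-local v v≤n) (verdict-local w (≤-trans w≤v v≤n))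
    where
    v≤n = leb-true {length v} eq

  consistent-local : ∀ n γ w x p → consistent? n (at (γ ↾ n)) w x p ≡ consistent? n γ w x p
  consistent-local n γ w x (ρ , σ) = cong₂ _∧_
    (cong (if inP? ρ then_else true) (agrees-local (w ++ ρ) (length-≤ˡ w ρ)))
    (cong (if leaf? ρ ∧ inP? σ then_else true)
      (agrees-local (w ++ ρ ++ x ∷ σ) (length-≤ˡ w (ρ ++ x ∷ σ))))

  Good : Baire → ℕ → Set
  Good γ d = valid? d ≡ true × Locked γ (word d) (bit d)

  locked-tail : ∀ {γ w x} σ → Locked γ w x → inP? σ ≡ true → verdict γ (w ++ σ) ≡ verdict γ w
  locked-tail {γ} {w} {x} σ locked σ∈P =
    eqb-true (if-true (if-true (proj₁ (∧-true (locked (length (w ++ σ)) (σ , [])))) σ∈P) (leb-≤ (≤-refl {length (w ++ σ)})))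

  locked-block : ∀ {γ w x} ρ σ → Locked γ w x → leaf? ρ ≡ true → inP? σ ≡ true →
    verdict γ (w ++ ρ ++ x ∷ σ) ≡ verdict γ w
  locked-block {γ} {w} {x} ρ σ locked ρ∈L σ∈P =
    eqb-true (if-true (if-true (proj₂ (∧-true (locked (length (w ++ ρ ++ x ∷ σ)) (ρ , σ))))
                               (∧-intro ρ∈L σ∈P))
                      (leb-≤ (≤-refl {length (w ++ ρ ++ x ∷ σ)})))

  data Extension (w : Str) (x : ℕ) : Str → Set where
    inTail     : ∀ {σ} → inP? σ ≡ true → Extension w x (w ++ σ)
    afterBlock : ∀ {ρ σ} → leaf? ρ ≡ true → inP? σ ≡ true → Extension w x (w ++ ρ ++ x ∷ σ)

  constant-locked : ∀ {γ w x} → ¬ (∃[ v ] (Extension w x v × verdict γ v ≢ verdict γ w)) → Locked γ w x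
  constant-locked {γ} {w} {x} none n (ρ , σ) = ∧-intro
    (if-intro λ p → agrees (inTail p))
    (if-intro λ p → agrees (afterBlock (proj₁ (∧-true p)) (proj₂ (∧-true p))))
    where
    agrees : ∀ {v} → Extension w x v → agrees? n γ w v ≡ true
    agrees {v} ext with verdict γ v ≟ verdict γ w
    ... | yes eq = if-intro λ _ → trans (cong (λ k → eqb k (verdict γ w)) eq) (eqb-refl (verdict γ w))
    ... | no  ne = contradiction (v , ext , ne) none

  good-unrefuted : ∀ {γ d} n → Good γ d → unrefuted? (γ ↾ n) d ≡ true
  good-unrefuted {γ} {d} n (v , locked) rewrite length-applyUpTo γ n =
    ∧-intro v (allBelow-true n λ z →
      trans (consistent-local n γ (word d) (bit d) (dec testNumbering z)) (locked n _))

  -- A failing test consults only finitely much of `γ` and keeps failing later. Without a failing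
  -- test, the candidate must be invalid, and then it never passes.
  bad-refuted : ExcludedMiddle 0ℓ → ∀ {γ d} → ¬ Good γ d →
    ∃[ N ] (∀ n → N ≤ n → unrefuted? (γ ↾ n) d ≢ true)
  bad-refuted em {γ} {d} bad with em {∃[ n ] ∃[ p ] (consistent? n γ (word d) (bit d) p ≢ true)}
  -- From `m` on the test `p` fails, and from `suc z` on it is among the tests performed.
  ... | yes (m , p , inc) = m ⊔ suc z , refuted
    where
    z : ℕ
    z = enc (list nat ⊠ list nat) p
    refuted : ∀ n → m ⊔ suc z ≤ n → unrefuted? (γ ↾ n) d ≢ true
    refuted n N≤n eq rewrite length-applyUpTo γ n =
      inc (consistent-antitone γ (word d) (bit d) p (m⊔n≤o⇒m≤o m _ N≤n)
        (trans (sym (consistent-local n γ (word d) (bit d) p))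
          (subst (λ p → consistent? n (at (γ ↾ n)) (word d) (bit d) p ≡ true) (dec-enc testNumbering p)
            (allBelow-elim n (proj₂ (∧-true {valid? d} eq)) (m⊔n≤o⇒n≤o m _ N≤n)))))
  ... | no none = 0 , λ n _ eq → bad (proj₁ (∧-true eq) , always)
    where
    always : ∀ m p → consistent? m γ (word d) (bit d) p ≡ true
    always m p with consistent? m γ (word d) (bit d) p in eq
    ... | true  = refl
    ... | false = contradiction (m , p , λ eq′ → contradiction (trans (sym eq) eq′) λ ()) none

  choice-least : ∀ σ d → d ≤ length σ → unrefuted? σ d ≡ true →
    (∀ d′ → d′ < d → unrefuted? σ d′ ≢ true) → choice σ ≡ d
  choice-least σ d d≤ ok least = go (length σ) d≤
    where
    step-true : ∀ {k d} → unrefuted? σ d ≡ true → (if unrefuted? σ d then d else suc k) ≡ d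
    step-true {k} {d} eq = cong (if_then d else suc k) eq
    step-false : ∀ {k d} → unrefuted? σ d ≢ true → (if unrefuted? σ d then d else suc k) ≡ suc k
    step-false {k} {d} eq = cong (if_then d else suc k) (not-false eq)
    S : ℕ → ℕ
    S = natrec 0 (λ k d → if unrefuted? σ d then d else suc k)
    before : ∀ k → k ≤ d → S k ≡ k
    before zero    _   = refl
    before (suc k) k<d rewrite before k (<⇒≤ k<d) = step-false (least k k<d)
    go : ∀ k → d ≤ k → S k ≡ d
    go k d≤k with m≤n⇒m<n∨m≡n d≤k
    ... | inj₂ refl = before k ≤-refl
    go (suc k) _ | inj₁ (s≤s d≤k) rewrite go k d≤k = step-true ok

  -- The least good candidate wins: it is never refuted, and each of the finitely many smaller ones
  -- eventually is.
  settles : ExcludedMiddle 0ℓ → ∀ γ → ∃ (Good γ) →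
    ∃[ d ] (Good γ d × (λ n → parameters (γ ↾ n)) ⟶
      enc (list nat ⊠ nat ⊠ nat) (word d , bit d , verdict γ (word d)))
  settles em γ ∃good with classicalLeast em (Good γ) ∃good
  -- The three bounds bring `d` within reach of `choice`, let the verdict on its word read true
  -- values of `γ`, and refute all smaller candidates.
  ... | d , good , least = d , good , (d ⊔ length (word d)) ⊔ proj₁ (refuted d ≤-refl) , limit
    where
    refuted : ∀ k → k ≤ d → ∃[ N ] (∀ n → N ≤ n → ∀ d′ → d′ < k → unrefuted? (γ ↾ n) d′ ≢ true)
    refuted zero    _   = 0 , λ _ _ _ ()
    refuted (suc k) k<d with refuted k (<⇒≤ k<d) | bad-refuted em (least k k<d)
    ... | N , r | N′ , r′ = N ⊔ N′ , both
      where
      both : ∀ n → N ⊔ N′ ≤ n → ∀ d′ → d′ < suc k → unrefuted? (γ ↾ n) d′ ≢ true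
      both n N≤n d′ d′<1+k with m≤n⇒m<n∨m≡n (≤-pred d′<1+k)
      ... | inj₁ d′<k = r n (m⊔n≤o⇒m≤o N N′ N≤n) d′ d′<k
      ... | inj₂ refl = r′ n (m⊔n≤o⇒n≤o N N′ N≤n)
    limit : ∀ n → (d ⊔ length (word d)) ⊔ proj₁ (refuted d ≤-refl) ≤ n → parameters (γ ↾ n) ≡
      enc (list nat ⊠ nat ⊠ nat) (word d , bit d , verdict γ (word d))
    limit n N≤n = begin
      parameters (γ ↾ n)
        ≡⟨ cong (λ d → enc (list nat ⊠ nat ⊠ nat) (word d , bit d , verdict (at (γ ↾ n)) (word d))) choice≡d ⟩
      enc (list nat ⊠ nat ⊠ nat) (word d , bit d , verdict (at (γ ↾ n)) (word d))
        ≡⟨ cong (λ e → enc (list nat ⊠ nat ⊠ nat) (word d , bit d , e))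
             (verdict-local (word d) (m⊔n≤o⇒n≤o d _ (m⊔n≤o⇒m≤o (d ⊔ _) _ N≤n))) ⟩
      enc (list nat ⊠ nat ⊠ nat) (word d , bit d , verdict γ (word d)) ∎
      where
      open ≡-Reasoning
      choice≡d : choice (γ ↾ n) ≡ d
      choice≡d = choice-least (γ ↾ n) d
        (≤-trans (m⊔n≤o⇒m≤o d _ (m⊔n≤o⇒m≤o (d ⊔ _) _ N≤n)) (≤-reflexive (sym (length-applyUpTo γ n))))
        (good-unrefuted n good)
        (proj₂ (refuted d ≤-refl) n (m⊔n≤o⇒n≤o (d ⊔ length (word d)) _ N≤n))

  module _ {L : Pred Str 0ℓ} (leaf-sound : ∀ {ρ} → leaf? ρ ≡ true → ρ ∈ L)
           (leaf-complete : ∀ {ρ} → ρ ∈ L → leaf? ρ ≡ true) where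

    assemble-sound : ∀ B → proj₂ (proj₂ (assemble B)) ≡ true →
      Blocks L (proj₁ (assemble B)) (proj₁ (proj₂ (assemble B)))
    assemble-sound B = go [] [] true B (λ _ → [])
      where
      go : ∀ τ w b B → (b ≡ true → Blocks L τ w) →
        let r = foldl addBlock (τ , w , b) B in
        proj₂ (proj₂ r) ≡ true → Blocks L (proj₁ r) (proj₁ (proj₂ r))
      go τ w b []            h = h
      go τ w b ((ρ , x) ∷ B) h = go _ _ _ B λ eq →
        block (leaf-sound (proj₁ (∧-true eq))) (h (proj₂ (∧-true eq)))

    assemble-complete : ∀ {τ w} → Blocks L τ w → ∃[ B ] assemble B ≡ (τ , w , true)
    assemble-complete []            = [] , refl
    assemble-complete (block {ρ} {x} ρ∈L bl) with assemble-complete bl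
    ... | B , eq = B ∷ʳ (ρ , x) , trans (foldl-∷ʳ addBlock _ (ρ , x) B)
      (cong₂ (λ r b → x ∷ proj₁ r , ρ ++ x ∷ proj₁ (proj₂ r) , b) eq
        (∧-intro (leaf-complete ρ∈L) (cong (proj₂ ∘ proj₂) eq)))

    good-blocks : ∀ {γ d} → Good γ d →
      ∃[ τ ] (Blocks L τ (word d) × inQ? (τ ++ bit d ∷ []) ≡ true)
    good-blocks {d = d} (v , _) with ∧-true {proj₂ (proj₂ (blocks d))} v
    ... | b , q = proj₁ (blocks d) , assemble-sound (proj₁ (dec candidateNumbering d)) b , q

    good-exists : ∀ {γ τ w x} → Blocks L τ w → inQ? (τ ++ x ∷ []) ≡ true → Locked γ w x → ∃ (Good γ)
    good-exists {γ} {τ} {w} {x} bl q locked with assemble-complete bl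
    ... | B , eq = d , ∧-intro (cong (proj₂ ∘ proj₂) blocks≡)
        (trans (cong₂ (λ r y → inQ? (proj₁ r ++ y ∷ [])) blocks≡ bit≡) q) ,
        subst₂ (Locked γ) (sym (cong (proj₁ ∘ proj₂) blocks≡)) (sym bit≡) locked
      where
      d : ℕ
      d = enc candidateT (B , x)
      blocks≡ : blocks d ≡ (τ , w , true)
      blocks≡ = trans (cong (assemble ∘ proj₁) (dec-enc candidateNumbering (B , x))) eq
      bit≡ : bit d ≡ x
      bit≡ = cong proj₂ (dec-enc candidateNumbering (B , x))

-- Locked pairs

snoc-++ : ∀ (w ρ : Str) x σ → (w ++ ρ ++ x ∷ []) ++ σ ≡ w ++ ρ ++ x ∷ σ
snoc-++ w ρ x σ = trans (++-assoc w (ρ ++ x ∷ []) σ) (cong (w ++_) (++-assoc ρ (x ∷ []) σ))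

blocks-snoc : ∀ {L τ w ρ x} → Blocks L τ w → ρ ∈ L → Blocks L (τ ++ x ∷ []) (w ++ ρ ++ x ∷ [])
blocks-snoc []                      ρ∈L = block ρ∈L []
blocks-snoc (block {ρ′} {y} {w = w} ρ′∈L bl) ρ∈L =
  subst (Blocks _ _) (sym (++-assoc ρ′ (y ∷ w) _)) (block ρ′∈L (blocks-snoc bl ρ∈L))

length-<-snoc : ∀ (w ρ : Str) x → length w < length (w ++ ρ ++ x ∷ [])
length-<-snoc []      []      x = s≤s z≤n
length-<-snoc []      (_ ∷ ρ) x = s≤s z≤n
length-<-snoc (_ ∷ w) ρ       x = s≤s (length-<-snoc w ρ x)

length-≤ʳ : ∀ (w v : Str) → length v ≤ length (w ++ v)
length-≤ʳ w v = ≤-trans (m≤n+m _ _) (≤-reflexive (sym (length-++ w)))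

module Reduction (em : ExcludedMiddle 0ℓ) {P Q : Pred Baire 0ℓ} (𝐏 : Π⁰₁ P) (𝐐 : Π⁰₁ Q)
  (P-special : Special P) (Q-special : Special Q)
  (guess : Str → ℕ) (guessᶜ : Comp (list nat) nat (λ _ → guess))
  where

  open Π⁰₁ 𝐏 using () renaming (tree to TP; isTree to TP-isTree; computable to TP-computable; paths to P-paths)
  open Π⁰₁ 𝐐 using () renaming (tree to TQ; isTree to TQ-isTree; computable to TQ-computable; paths to Q-paths)

  TP-decider : Decider TP
  TP-decider = decider TP-computable

  TQ-decider : Decider TQ
  TQ-decider = decider TQ-computable

  open Leaves TP-isTree TP-decider
  open Extraction leaf? leaf?ᶜ
  open Decider
  open Learning guess guessᶜ (mem? TP-decider) (mem? TQ-decider) leaf?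
    (mem?ᶜ TP-decider) (mem?ᶜ TQ-decider) leaf?ᶜ extract public

  no-computable-path : ∀ f → f ∈ Paths TP → ¬ Computable f
  no-computable-path f f∈ = proj₂ P-special f (proj₂ P-paths f∈)

  f₀ : Path TP
  f₀ = proj₁ (proj₁ P-special) , proj₁ P-paths (proj₂ (proj₁ P-special))

  extend-to-leaf : ∀ {σ} → mem? TP-decider σ ≡ true → ∃[ e ] Leaf TP (σ ++ e)
  extend-to-leaf {σ} σ∈ = leaf-above em no-computable-path σ (mem-sound TP-decider σ∈)

  -- All that is used of an element γ of R.
  Reducing : Baire → Set
  Reducing γ = ∀ f → f ∈ 𝐐 ▼ 𝐏 → ∃[ e ] ∃[ h ]
    ((λ n → guess ((f ⊕ γ) ↾ n)) ⟶ e × Φ e · f ⊕ γ ≃ h × h ∈ Paths TP)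

  module _ {γ : Baire} where

    module _ {τ : Baire} (τ∈Q : τ ∈ Paths TQ) where

      Stage : Set
      Stage = ∃[ k ] ∃[ w ] Blocks (Leaf TP) (τ ↾ k) w

      word-of : Stage → Str
      word-of s = proj₁ (proj₂ s)

      -- The words of both stages and `between` are nested, so any sequence through the next word
      -- passes both strings on which the verdicts differ.
      record Change (s : Stage) : Set where
        field
          next-stage : Stage
          extends    : ∃[ e ] word-of next-stage ≡ word-of s ++ e
          longer     : length (word-of s) < length (word-of next-stage)
          between    : Str
          between-≤  : ∃[ e ] word-of next-stage ≡ between ++ e
          between-≥  : length (word-of s) ≤ length between
          changes    : verdict γ between ≢ verdict γ (word-of s)

      snoc : ∀ {k w ρ} → Blocks (Leaf TP) (τ ↾ k) w → Leaf TP ρ →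
             Blocks (Leaf TP) (τ ↾ suc k) (w ++ ρ ++ τ k ∷ [])
      snoc {k} {w} {ρ} bl ρ∈L = subst (λ τ′ → Blocks (Leaf TP) τ′ (w ++ ρ ++ τ k ∷ [])) (applyUpTo-∷ʳ τ k) (blocks-snoc bl ρ∈L)

      -- The string that ends at the change is completed to a leaf and closed by the next value of
      -- `τ`. A change in the tail uses up one block, a change after a block two.
      change : ∀ (s : Stage) {v} → Extension (word-of s) (τ (proj₁ s)) v →
               verdict γ v ≢ verdict γ (word-of s) → Change s
      change (k , w , bl) (inTail {σ} σ∈) ne with extend-to-leaf σ∈
      ... | e , leaf = record
        { next-stage = suc k , _ , snoc bl leaf
        ; extends    = _ , refl
        ; longer     = length-<-snoc w (σ ++ e) (τ k)
        ; between    = w ++ σ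
        ; between-≤  = e ++ τ k ∷ [] , trans (cong (w ++_) (++-assoc σ e _)) (sym (++-assoc w σ _))
        ; between-≥  = length-≤ˡ w σ
        ; changes    = ne
        }
      change (k , w , bl) (afterBlock {ρ} {σ} ρ∈ σ∈) ne with extend-to-leaf σ∈
      ... | e , leaf = record
        { next-stage = suc (suc k) , _ , snoc (snoc bl (leaf?-sound ρ∈)) leaf
        ; extends    = _ , ++-assoc w (ρ ++ τ k ∷ []) _
        ; longer     = ≤-trans (length-<-snoc w ρ (τ k)) (length-≤ˡ (w ++ ρ ++ τ k ∷ []) _)
        ; between    = w ++ ρ ++ τ k ∷ σ
        ; between-≤  = e ++ τ (suc k) ∷ [] , (begin
            (w ++ ρ ++ τ k ∷ []) ++ (σ ++ e) ++ τ (suc k) ∷ []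
              ≡⟨ cong ((w ++ ρ ++ τ k ∷ []) ++_) (++-assoc σ e _) ⟩
            (w ++ ρ ++ τ k ∷ []) ++ σ ++ e ++ τ (suc k) ∷ []
              ≡⟨ ++-assoc (w ++ ρ ++ τ k ∷ []) σ _ ⟨
            ((w ++ ρ ++ τ k ∷ []) ++ σ) ++ e ++ τ (suc k) ∷ []
              ≡⟨ cong (_++ e ++ τ (suc k) ∷ []) (snoc-++ w ρ (τ k) σ) ⟩
            (w ++ ρ ++ τ k ∷ σ) ++ e ++ τ (suc k) ∷ [] ∎)
        ; between-≥  = length-≤ˡ w _
        ; changes    = ne
        }
        where open ≡-Reasoning

      -- One change beyond the modulus `N` suffices: `W N` and the following `between` have length
      -- at least `N` and lie on the limit, so both verdicts equal the final guess.
      always-changing : (∀ s → Change s) → ¬ Reducing γ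
      always-changing c red = Change.changes (c (S N)) (trans
          (verdict≡e between between-◁ (≤-trans (W-long N) (Change.between-≥ (c (S N)))))
          (sym (verdict≡e (W N) (limit-◁ N) (W-long N))))
        where
        S : ℕ → Stage
        S zero    = 0 , [] , []
        S (suc n) = Change.next-stage (c (S n))

        W : ℕ → Str
        W n = word-of (S n)

        W-long : ∀ n → n ≤ length (W n)
        W-long zero    = z≤n
        W-long (suc n) = ≤-trans (s≤s (W-long n)) (Change.longer (c (S n)))

        open Limit W (λ n → Change.extends (c (S n))) W-long

        limit∈ : limit ∈ 𝐐 ▼ 𝐏
        -- The word alone covers the first `n` places, so the last part is empty; `f₀ ↾ 0` shows
        -- that T_P contains the empty string.
        limit∈ n = _ , W n , [] , τ∈Q (proj₁ (S n)) , proj₂ (proj₂ (S n)) , proj₂ f₀ 0 ,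
          covers-prefix n (W n ++ []) (subst (Covers limit n) (sym (++-identityʳ (W n))) (limit-covers n))

        e N : ℕ
        e = proj₁ (red limit limit∈)
        N = proj₁ (proj₁ (proj₂ (proj₂ (red limit limit∈))))

        verdict≡e : ∀ v → v ◁ limit → N ≤ length v → verdict γ v ≡ e
        verdict≡e v v◁ N≤ = trans (verdict-limit {γ} {v} v◁)
          (proj₂ (proj₁ (proj₂ (proj₂ (red limit limit∈)))) _ (≤-trans N≤ (m≤m+n _ _)))

        between : Str
        between = Change.between (c (S N))

        between-◁ : between ◁ limit
        between-◁ = ◁-++ between {proj₁ (Change.between-≤ (c (S N)))}
          (subst (_◁ limit) (proj₂ (Change.between-≤ (c (S N)))) (limit-◁ (suc N)))

      good-candidate : Reducing γ → ∃ (Good γ)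
      good-candidate red = decidable-stable em λ none → always-changing (changing none) red
        where
        Changing : Str → ℕ → Set
        Changing w x = ∃[ v ] (Extension w x v × verdict γ v ≢ verdict γ w)
        changing : ¬ ∃ (Good γ) → ∀ s → Change s
        changing none s@(k , w , bl) = change s (proj₁ (proj₂ found)) (proj₂ (proj₂ found))
          where
          τ∷∈TQ : τ ↾ k ++ τ k ∷ [] ∈ TQ
          τ∷∈TQ = subst TQ (sym (applyUpTo-∷ʳ τ k)) (τ∈Q (suc k))
          found : Changing w (τ k)
          found = decidable-stable em λ constant → none
            (good-exists leaf?-sound leaf?-complete {γ} {τ ↾ k} {w} {τ k} bl
              (mem-complete TQ-decider τ∷∈TQ) (constant-locked {γ} {w} {τ k} constant))

    module _ (red : Reducing γ) where

      -- The guesses along `f ⊕ γ` converge, so a verdict that recurs on arbitrarily long initial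
      -- segments is their limit.
      constant-index : ∀ {f E} → f ∈ 𝐐 ▼ 𝐏 → (∀ N → ∃[ v ] (v ◁ f × N ≤ length v × verdict γ v ≡ E)) →
        ∃[ h ] ∃[ c ] (# c ≡ E × (∀ n → f ⊕ γ ⊢ c · n ⇓ proj₁ {B = Paths TP} h n))
      constant-index {f} {E} f∈ vs with red f f∈
      ... | e , h , (N , lim) , (c , #c , c⇓) , h∈ with vs N
      ...   | v , v◁ , N≤ , eq = (h , h∈) , c , trans #c e≡E , c⇓
        where
        e≡E : e ≡ E
        e≡E = trans (sym (lim _ (≤-trans N≤ (m≤m+n _ _)))) (trans (sym (verdict-limit {γ} {v} v◁)) eq)

      -- Each `f` comes with its own code of number `E`, but the extraction needs one code for all;
      -- they coincide because `#` is injective.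
      same-code : ∀ {f E c} → # c ≡ E →
        ∃[ h ] ∃[ c′ ] (# c′ ≡ E × (∀ n → f ⊕ γ ⊢ c′ · n ⇓ proj₁ {B = Paths TP} h n)) →
        ∃[ h ] (∀ n → f ⊕ γ ⊢ c · n ⇓ proj₁ {B = Paths TP} h n)
      same-code {c = c} #c (h , c′ , #c′ , c′⇓) =
        h , λ n → subst (_ ⊢_· n ⇓ _) (#-injective {c′} {c} (trans #c′ (sym #c))) (c′⇓ n)

      locked-extracts : ∀ {τ w x} → Blocks (Leaf TP) τ w → τ ++ x ∷ [] ∈ TQ → Locked γ w x →
        ∃[ h ] (Paths TP h × (∀ n →
          γ ⊢ extract · ⟨ enc (list nat ⊠ nat ⊠ nat) (w , x , verdict γ w) , n ⟩ ⇓ h n))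
      locked-extracts {τ} {w} {x} bl τx∈TQ locked =
        subst (λ e → ∃[ h ] (Paths TP h × (∀ n → γ ⊢ extract · ⟨ enc (list nat ⊠ nat ⊠ nat) (w , x , e) , n ⟩ ⇓ h n)))
          #c (extract-correct {TP} γ w x c (λ f → same-code #c (tail-run f))
                (λ ρ ρ∈L f → same-code #c (block-run ρ ρ∈L f)) f₀ dense)
        where
        ⊑-++ : ∀ (σ ρ : Str) → σ ⊑ σ ++ ρ
        ⊑-++ []      ρ = []
        ⊑-++ (y ∷ σ) ρ = refl ∷ ⊑-++ σ ρ
        ↾-covers : ∀ f n → Covers f n (f ↾ n)
        ↾-covers f n i i<n = nth-applyUpTo f n i<n

        tail-path : (f : Path TP) → cat w (proj₁ f) ∈ 𝐐 ▼ 𝐏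
        tail-path (f , f∈) n = τ , w , f ↾ n , IsBinaryTree.closed TQ-isTree _ _ (⊑-++ τ _) τx∈TQ , bl , f∈ n ,
          covers-prefix n _ (cat-covers w (↾-covers f n))

        block-path : ∀ {ρ} → Leaf TP ρ → (f : Path TP) → cat w (cat ρ (cat (x ∷ []) (proj₁ f))) ∈ 𝐐 ▼ 𝐏
        block-path {ρ} ρ∈L (f , f∈) n = _ , w ++ ρ ++ x ∷ [] , f ↾ n , τx∈TQ , blocks-snoc bl ρ∈L , f∈ n ,
          covers-prefix n _ (subst (Covers _ n) (sym (snoc-++ w ρ x (f ↾ n)))
            (cat-covers w (cat-covers ρ (cat-covers (x ∷ []) (↾-covers f n)))))

        long : ∀ f n v → n ≤ length (v ++ f ↾ n)
        long f n v = ≤-trans (≤-reflexive (sym (length-applyUpTo f n))) (length-≤ʳ v (f ↾ n))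

        tail-run : (f : Path TP) → ∃[ h ] ∃[ c ] (# c ≡ verdict γ w ×
          (∀ n → cat w (proj₁ f) ⊕ γ ⊢ c · n ⇓ proj₁ {B = Paths TP} h n))
        tail-run (f , f∈) = constant-index (tail-path (f , f∈)) λ n →
          w ++ f ↾ n , cat-◁ w (↾-◁ f n) , long f n w , locked-tail (f ↾ n) locked (mem-complete TP-decider (f∈ n))

        block-run : ∀ ρ → leaf? ρ ≡ true → (f : Path TP) → ∃[ h ] ∃[ c ] (# c ≡ verdict γ w ×
          (∀ n → cat w (cat ρ (cat (x ∷ []) (proj₁ f))) ⊕ γ ⊢ c · n ⇓ proj₁ {B = Paths TP} h n))
        block-run ρ ρ∈L (f , f∈) = constant-index (block-path (leaf?-sound ρ∈L) (f , f∈)) λ n →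
          w ++ ρ ++ x ∷ f ↾ n , cat-◁ w (cat-◁ ρ (cat-◁ (x ∷ []) (↾-◁ f n))) ,
          ≤-trans (long f n (x ∷ [])) (≤-trans (length-≤ʳ ρ _) (length-≤ʳ w _)) ,
          locked-block ρ (f ↾ n) locked ρ∈L (mem-complete TP-decider (f∈ n))

        c : Code
        -- Not every number is the number of a code; the run along w ⌢ `f₀` shows that this verdict
        -- is one.
        c = proj₁ (proj₂ (tail-run f₀))

        #c : # c ≡ verdict γ w
        #c = proj₁ (proj₂ (proj₂ (tail-run f₀)))

        dense : ∀ m → ∃[ ρ ] (leaf? ρ ≡ true × Covers (proj₁ f₀) m ρ)
        dense m with extend-to-leaf (mem-complete TP-decider (proj₂ f₀ m))
        ... | e , leaf = proj₁ f₀ ↾ m ++ e , leaf?-complete leaf ,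
          λ i i<m → nth-++ˡ (proj₁ f₀ ↾ m) e {i} (nth-applyUpTo (proj₁ f₀) m i<m)

      good-extracts : ∀ d → Good γ d → ∃[ h ] (Paths TP h × (∀ n →
        γ ⊢ extract · ⟨ enc (list nat ⊠ nat ⊠ nat) (word d , bit d , verdict γ (word d)) , n ⟩ ⇓ h n))
      good-extracts d good =
        let (τ , bl , τx∈TQ) = good-blocks leaf?-sound leaf?-complete {γ} {d} good in
        locked-extracts bl (mem-sound TQ-decider τx∈TQ) (proj₂ good)

      Converges : ℕ → Set
      Converges m = ∃[ h ] ((λ n → parameters (γ ↾ n)) ⟶ m ×
        (∀ n → γ ⊢ program m extract · n ⇓ h n) × h ∈ Paths TP)

      limit-converges : ∀ m → (λ n → parameters (γ ↾ n)) ⟶ m →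
        ∃[ h ] (Paths TP h × (∀ n → γ ⊢ extract · ⟨ m , n ⟩ ⇓ h n)) → Converges m
      limit-converges m limit (h , h∈ , h⇓) =
        h , limit , (λ n → program-correct {c = extract} {m = m} (h⇓ n)) , h∈

      good-converges : ∃[ d ] (Good γ d × (λ n → parameters (γ ↾ n)) ⟶
        enc (list nat ⊠ nat ⊠ nat) (word d , bit d , verdict γ (word d))) → ∃ Converges
      good-converges (d , good , limit) = _ , limit-converges _ limit (good-extracts d good)

      converges : ∃ Converges
      converges =
        good-converges (settles em γ (good-candidate (proj₁ Q-paths (proj₂ (proj₁ Q-special))) red))

  -- The learner must succeed on the whole domain, and R may live in any universe; so the domain
  -- collects all `γ` on which the parameters converge and the extraction yields a path.
  Γ : PartialFunction
  Γ = record
    { dom      = λ γ → ∃[ m ] ∃[ h ] ((λ n → parameters (γ ↾ n)) ⟶ m ×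
                   (∀ n → γ ⊢ program m extract · n ⇓ h n) × h ∈ Paths TP)
    ; apply    = λ γ p → proj₁ (proj₂ p)
    ; respects = respects
    }
    where
    respects : ∀ {g g′} (p : ∃[ m ] ∃[ h ] ((λ n → parameters (g ↾ n)) ⟶ m ×
                   (∀ n → g ⊢ program m extract · n ⇓ h n) × h ∈ Paths TP))
                 (q : ∃[ m ] ∃[ h ] ((λ n → parameters (g′ ↾ n)) ⟶ m ×
                   (∀ n → g′ ⊢ program m extract · n ⇓ h n) × h ∈ Paths TP)) →
               g ≗ g′ → proj₁ (proj₂ p) ≗ proj₁ (proj₂ q)
    respects {g} {g′} (m , h , (N , lim) , h⇓ , _) (m′ , h′ , (N′ , lim′) , h′⇓ , _) eq n =
      ⇓-deterministic eq (h⇓ n) (subst (λ m → g′ ⊢ program m extract · n ⇓ h′ n) (sym m≡m′) (h′⇓ n))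
      where
      m≡m′ : m ≡ m′
      m≡m′ = trans (sym (lim (N ⊔ N′) (m≤m⊔n N N′)))
        (trans (cong parameters (↾-cong (N ⊔ N′) λ i _ → eq i)) (lim′ (N ⊔ N′) (m≤n⊔m N N′)))

  Γ-learns : ∀ g (p : g ∈ PartialFunction.dom Γ) →
    ∃[ e ] ((λ n → newGuess (g ↾ n)) ⟶ e × Φ e · g ≃ PartialFunction.apply Γ g p)
  Γ-learns g (m , h , (N , lim) , h⇓ , _) =
    # (program m extract) , (N , λ n N≤n → cong (λ m → # (program m extract)) (lim n N≤n)) ,
    program m extract , refl , h⇓

theorem53 : ExcludedMiddle 0ℓ →
    (P Q : Pred Baire 0ℓ) (𝐏 : Π⁰₁ P) (𝐐 : Π⁰₁ Q) →
    Special P → Special Q →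
    {ℓ : Level} (R : Pred Baire ℓ) →
    P ≤¹ω ((𝐐 ▼ 𝐏) ⊗ R) → P ≤¹ω R
theorem53 em P Q 𝐏 𝐐 P-special Q-special R r = record
  { Γ       = Γ
  ; Ψ       = newLearner
  ; defined = λ {g} g∈R → converges (reducing g g∈R)
  ; correct = λ g g∈R → proj₂ (Π⁰₁.paths 𝐏) (proj₂ (proj₂ (proj₂ (proj₂ (converges (reducing g g∈R))))))
  ; learns  = Γ-learns
  }
  where
  open _≤¹ω_ r using () renaming (Ψ to Ψ₀; defined to defined₀; correct to correct₀; learns to learns₀)
  open Reduction em 𝐏 𝐐 P-special Q-special (Learner.guess Ψ₀) (fromComputable (Learner.computable Ψ₀))

  reducing : ∀ g → g ∈ R → Reducing g
  reducing g g∈R f f∈ with learns₀ (f ⊕ g) (defined₀ p)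
    where
    p : (f ⊕ g) ∈ (𝐐 ▼ 𝐏) ⊗ R
    p = f , g , f∈ , g∈R , λ _ → refl
  ... | e , lim , Φe = e , _ , lim , Φe , proj₁ (Π⁰₁.paths 𝐏) (correct₀ (f ⊕ g) (f , g , f∈ , g∈R , λ _ → refl))
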